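{- Let $K$ and $L$ be étale bigraphs. Then $\rho(K\times_{B_2}L)\le\rho(K)\,\rho(L)$.
   Context: A digraph $G=(V_G,E_G,t_G,h_G)$ consists of finite sets $V_G,E_G$ and maps $t_G,h_G\colon E_G\to V_G$ (tail, head); multiple edges and self-loops are allowed. A bigraph is a digraph each of whose edges is coloured $1$ or $2$; it is étale if no vertex is the head of two distinct edges of the same colour and no vertex is the tail of two distinct edges of the same colour. For bigraphs $K,L$, the fibre product $K\times_{B_2}L$ is the digraph with vertex set $V_K\times V_L$, edge set the pairs $(e_1,e_2)\in E_K\times E_L$ with $e_1,e_2$ of the same colour, tail $(t e_1,te_2)$ and head $(he_1,he_2)$. For a digraph $G$ regarded as an undirected graph and a connected component $X$, let $h_1(X)=|E_X|-|V_X|+1$; the reduced cyclicity is $\rho(G)=\sum_{X}\max(0,h_1(X)-1)$, the sum over connected components $X$ of $G$. -}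

module Defs where

open import Data.Empty using (⊥-elim)
open import Data.Fin using (Fin; zero; suc)
open import Data.Fin.Properties using (_≟_; *↔×; +↔⊎; 0↔⊥; 1↔⊤)
open import Data.Integer using (ℤ; +_; 0ℤ; 1ℤ; _+_; _-_; _⊔_)
open import Data.List using (List; []; _∷_; allFin; deduplicate; filter; foldr; length; map)
open import Data.List.Membership.Propositional using (_∈_)
open import Data.List.Membership.Propositional.Properties using (∈-map⁺; ∈-map⁻; ∈-allFin)
open import Data.List.Relation.Unary.Any using (here; there)
open import Data.Nat using (ℕ; zero; suc)
open import Data.Product using (Σ; ∃; _×_; _,_; proj₁; proj₂)
open import Data.Product.Function.NonDependent.Propositional using (_×-↔_)
open import Data.Sum using (_⊎_; inj₁; inj₂; [_,_]′)
open import Data.Sum.Function.Propositional using (_⊎-↔_)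
open import Data.Unit using (⊤; tt)
open import Function.Base using (_∘_)
open import Function.Bundles using (_↔_; Inverse; mk↔ₛ′)
open import Function.Construct.Composition using (_↔-∘_)
open import Function.Construct.Symmetry using (↔-sym)
open import Function.Properties.Inverse using (↔⇒↣)
open import Relation.Binary.Construct.Closure.Equivalence as Eq using (EqClosure)
open import Relation.Binary.Construct.Closure.ReflexiveTransitive using (ε; _◅_)
open import Relation.Binary.Construct.Closure.Symmetric using (fwd; bwd)
open import Relation.Binary.Core using (Rel)
import Relation.Binary.Definitions as Binary
open import Relation.Binary.PropositionalEquality
open import Relation.Nullary.Decidable using (Dec; yes; no; map′; via-injection; _×-dec_; _⊎-dec_)
open import Relation.Nullary.Irrelevant using (Irrelevant)
open import Relation.Unary using (Decidable)
open import Axiom.UniquenessOfIdentityProofs using (module Decidable⇒UIP)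

Finite : Set → Set
Finite A = ∃ λ n → A ↔ Fin n

module _ {A : Set} where

  elements : Finite A → List A
  elements (n , A↔n) = map (Inverse.from A↔n) (allFin n)

  ∈-elements : (fin : Finite A) → ∀ a → a ∈ elements fin
  ∈-elements (n , A↔n) a =
    subst (_∈ elements (n , A↔n)) (Inverse.strictlyInverseʳ A↔n a)
      (∈-map⁺ (Inverse.from A↔n) (∈-allFin (Inverse.to A↔n a)))

  finite⇒≟ : Finite A → Binary.DecidableEquality A
  finite⇒≟ (_ , A↔n) = via-injection (↔⇒↣ A↔n) _≟_

module _ {A B : Set} where

  finite-↔ : A ↔ B → Finite B → Finite A
  finite-↔ A↔B (n , B↔n) = n , B↔n ↔-∘ A↔B

  finite-× : Finite A → Finite B → Finite (A × B)
  finite-× (_ , A↔m) (_ , B↔n) = _ , ↔-sym *↔× ↔-∘ (A↔m ×-↔ B↔n)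

  finite-⊎ : Finite A → Finite B → Finite (A ⊎ B)
  finite-⊎ (_ , A↔m) (_ , B↔n) = _ , ↔-sym +↔⊎ ↔-∘ (A↔m ⊎-↔ B↔n)

finite-dec : {P : Set} → Dec P → Irrelevant P → Finite P
finite-dec (yes p) irr = 1 , ↔-sym 1↔⊤ ↔-∘ mk↔ₛ′ (λ _ → tt) (λ _ → p) (λ _ → refl) (irr p)
finite-dec (no ¬p) irr = 0 , ↔-sym 0↔⊥ ↔-∘ mk↔ₛ′ ¬p ⊥-elim (λ ()) (λ p → ⊥-elim (¬p p))

Σ-≡ : {A : Set} {P : A → Set} → (∀ a → Irrelevant (P a)) →
      {x y : Σ A P} → proj₁ x ≡ proj₁ y → x ≡ y
Σ-≡ irr {a , p} {.a , q} refl = cong (a ,_) (irr a p q)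

finite-Σ-Fin : ∀ n {P : Fin n → Set} → Decidable P → (∀ i → Irrelevant (P i)) →
               Finite (Σ (Fin n) P)
finite-Σ-Fin zero    P? irr = 0 , mk↔ₛ′ proj₁ (λ ()) (λ ()) (λ { (() , _) })
finite-Σ-Fin (suc n) {P} P? irr =
  finite-↔ split (finite-⊎ (finite-dec (P? zero) (irr zero))
                           (finite-Σ-Fin n (P? ∘ suc) (irr ∘ suc)))
  where
  split : Σ (Fin (suc n)) P ↔ (P zero ⊎ Σ (Fin n) (P ∘ suc))
  split = mk↔ₛ′
    (λ { (zero , p) → inj₁ p ; (suc i , p) → inj₂ (i , p) })
    [ (λ p → zero , p) , (λ { (i , p) → suc i , p }) ]′
    (λ { (inj₁ _) → refl ; (inj₂ _) → refl })
    (λ { (zero , _) → refl ; (suc _ , _) → refl })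

finite-Σ : {A : Set} {P : A → Set} → Finite A → Decidable P → (∀ a → Irrelevant (P a)) →
           Finite (Σ A P)
finite-Σ {A} {P} (n , A↔n) P? irr =
  finite-↔ transport (finite-Σ-Fin n (P? ∘ from) (irr ∘ from))
  where
  open Inverse A↔n
  transport : Σ A P ↔ Σ (Fin n) (P ∘ from)
  transport = mk↔ₛ′
    (λ { (a , p) → to a , subst P (sym (strictlyInverseʳ a)) p })
    (λ { (i , p) → from i , p })
    (λ { (i , p) → Σ-≡ (irr ∘ from) (strictlyInverseˡ i) })
    (λ { (a , p) → Σ-≡ irr (strictlyInverseʳ a) })

Listed : {A : Set} → List (A × A) → Rel A _
Listed ps u v = (u , v) ∈ ps

module _ {A : Set} (_≟A_ : Binary.DecidableEquality A) where

  listed-closure? : ∀ ps → Binary.Decidable (EqClosure (Listed {A} ps))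
  listed-closure? []             u v = map′ (λ { refl → ε }) to (u ≟A v)
    where
    to : ∀ {u v} → EqClosure (Listed []) u v → u ≡ v
    to ε             = refl
    to (fwd () ◅ _)
    to (bwd () ◅ _)
  listed-closure? ((s , t) ∷ ps) u v =
    map′ from to (  (u ~? v)
               ⊎-dec ((u ~? s) ×-dec (t ~? v))
               ⊎-dec ((u ~? t) ×-dec (s ~? v)))
    where
    _~_ = EqClosure (Listed ps)
    _~′_ = EqClosure (Listed ((s , t) ∷ ps))
    _~?_ = listed-closure? ps
    _⨾_ : ∀ {x y z} → x ~′ y → y ~′ z → x ~′ z
    _⨾_ = Eq.transitive (Listed ((s , t) ∷ ps))
    trans~ : ∀ {x y z} → x ~ y → y ~ z → x ~ z
    trans~ = Eq.transitive (Listed ps)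

    Via : Rel A _
    Via x y = (x ~ y) ⊎ ((x ~ s) × (t ~ y)) ⊎ ((x ~ t) × (s ~ y))

    weaken : ∀ {x y} → x ~ y → x ~′ y
    weaken = Eq.map there

    from : ∀ {x y} → Via x y → x ~′ y
    from (inj₁ p)              = weaken p
    from (inj₂ (inj₁ (p , q))) = weaken p ⨾ (fwd (here refl) ◅ weaken q)
    from (inj₂ (inj₂ (p , q))) = weaken p ⨾ (bwd (here refl) ◅ weaken q)

    extend : ∀ {x y z} → x ~ y → Via y z → Via x z
    extend p (inj₁ q)              = inj₁ (trans~ p q)
    extend p (inj₂ (inj₁ (q , r))) = inj₂ (inj₁ (trans~ p q , r))
    extend p (inj₂ (inj₂ (q , r))) = inj₂ (inj₂ (trans~ p q , r))

    to : ∀ {x y} → x ~′ y → Via x y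
    to ε                        = inj₁ ε
    to (fwd (there m)   ◅ rest) = extend (fwd m ◅ ε) (to rest)
    to (bwd (there m)   ◅ rest) = extend (bwd m ◅ ε) (to rest)
    to (fwd (here refl) ◅ rest) with to rest
    ... | inj₁ p              = inj₂ (inj₁ (ε , p))
    ... | inj₂ (inj₁ (_ , p)) = inj₂ (inj₁ (ε , p))
    ... | inj₂ (inj₂ (_ , p)) = inj₁ p
    to (bwd (here refl) ◅ rest) with to rest
    ... | inj₁ p              = inj₂ (inj₂ (ε , p))
    ... | inj₂ (inj₁ (_ , p)) = inj₁ p
    ... | inj₂ (inj₂ (_ , p)) = inj₂ (inj₂ (ε , p))

record Digraph : Set₁ where
  field
    V E  : Set
    finV : Finite V
    finE : Finite E
    tail : E → V
    head : E → V

  Adjacent : Rel V _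
  Adjacent u v = ∃ λ e → tail e ≡ u × head e ≡ v

  Connected : Rel V _
  Connected = EqClosure Adjacent

  connected? : Binary.Decidable Connected
  connected? u v =
    map′ (Eq.map listed⇒adjacent) (Eq.map adjacent⇒listed)
         (listed-closure? (finite⇒≟ finV) (map ends (elements finE)) u v)
    where
    ends : E → V × V
    ends e = tail e , head e
    listed⇒adjacent : ∀ {x y} → Listed (map ends (elements finE)) x y → Adjacent x y
    listed⇒adjacent m with ∈-map⁻ ends m
    ... | e , _ , refl = e , refl , refl
    adjacent⇒listed : ∀ {x y} → Adjacent x y → Listed (map ends (elements finE)) x y
    adjacent⇒listed (e , refl , refl) = ∈-map⁺ ends (∈-elements finE e)

  -- A component is represented by a vertex in it; this list contains exactly
  -- one vertex of each component.
  components : List V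
  components = deduplicate connected? (elements finV)

  componentV : V → List V
  componentV x = filter (connected? x) (elements finV)

  -- The head of an edge lies in the same component as its tail.
  componentE : V → List E
  componentE x = filter (connected? x ∘ tail) (elements finE)

  h₁ : V → ℤ
  h₁ x = + length (componentE x) - + length (componentV x) + 1ℤ

  ρ : ℤ
  ρ = foldr _+_ 0ℤ (map (λ x → 0ℤ ⊔ (h₁ x - 1ℤ)) components)

open Digraph public using (ρ)

Colour : Set
Colour = Fin 2

record Bigraph : Set₁ where
  field
    digraph : Digraph
  open Digraph digraph public
  field
    colour : E → Colour

record Étale (K : Bigraph) : Set where
  open Bigraph K
  field
    head-injective : ∀ {e e′} → colour e ≡ colour e′ → head e ≡ head e′ → e ≡ e′
    tail-injective : ∀ {e e′} → colour e ≡ colour e′ → tail e ≡ tail e′ → e ≡ e′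

_×B₂_ : Bigraph → Bigraph → Digraph
K ×B₂ L = record
  { V    = K.V × L.V
  ; E    = Σ (K.E × L.E) λ (e₁ , e₂) → K.colour e₁ ≡ L.colour e₂
  ; finV = finite-× K.finV L.finV
  ; finE = finite-Σ (finite-× K.finE L.finE)
             (λ (e₁ , e₂) → K.colour e₁ ≟ L.colour e₂)
             (λ _ → Decidable⇒UIP.≡-irrelevant _≟_)
  ; tail = λ ((e₁ , e₂) , _) → K.tail e₁ , L.tail e₂
  ; head = λ ((e₁ , e₂) , _) → K.head e₁ , L.head e₂
  }
  where
  module K = Bigraph K
  module L = Bigraph L

{-# OPTIONS --safe #-}

-- The proof is a finite version of Mineyev's argument with an order on the edges of the
-- universal covers.  The étale condition makes the (at most four) darts leaving a vertex
-- distinguishable by colour and direction, so summing a turn term ±1 at each vertex and an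
-- orientation term ±1 at each inner edge of a non-backtracking walk gives an odd integer whose
-- sign compares the first edge with the last; this is a total order on the edges of the
-- universal cover (Dicks-Šunić), and it is preserved by the projections of K ×B₂ L.
--
-- An edge is essential if it is the largest edge of a non-backtracking walk that extends far
-- beyond it in both directions.  Removing the essential edges from a component leaves no piece
-- with two independent cycles, since such a piece carries a line with a largest edge; and, if
-- there was an essential edge, it leaves no piece that is a tree, since crossing such a piece
-- downhill would have to go on forever.  Hence the number of essential edges is at least ρ for
-- every étale bigraph, and at most ρ once the walks are required to be long enough.  Both edges
-- underlying an essential edge of K ×B₂ L are essential, so the product bound follows.
module Submission where

open import Defs
open import Axiom.UniquenessOfIdentityProofs using (module Decidable⇒UIP)
open import Data.Bool using (Bool; true; false; not)
import Data.Bool.Properties as Bool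
open import Data.Bool.Properties using (not-involutive)
open import Data.Empty using (⊥)
open import Data.Fin using (zero; suc; toℕ)
import Data.Fin.Properties as Fin
open import Data.Fin.Properties using (pigeonhole; 2↔Bool)
open import Data.List using (List; []; _∷_; _++_; filter; length; map; foldr; cartesianProduct)
open import Data.List.Properties using (length-++; length-map)
open import Data.List.Membership.Propositional using (_∈_; find; lose)
open import Data.List.Membership.Propositional.Properties
  using (∈-map⁺; ∈-map⁻; ∈-++⁺ˡ; ∈-++⁺ʳ; ∈-filter⁺; ∈-filter⁻; ∈-cartesianProduct⁺)
open import Data.List.Relation.Unary.All as All using (all?)
open import Data.List.Relation.Unary.AllPairs as AllPairs using (AllPairs; []; _∷_)
open import Data.List.Relation.Unary.Any as Any using (here; there; any?)
import Data.List.Relation.Unary.Any.Properties as Any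
open import Data.List.Relation.Unary.Unique.DecSetoid.Properties using (deduplicate-!)
open import Data.List.Relation.Unary.Unique.Propositional using (Unique)
import Data.List.Relation.Unary.Unique.Propositional.Properties as Unique
open import Data.Nat using (ℕ; zero; suc)
import Data.Nat as ℕ
import Data.Nat.Properties as ℕ
open import Data.Product using (∃; ∃₂; _×_; _,_; proj₁; proj₂)
open import Data.Product.Properties using (≡-dec; ,-injectiveˡ)
open import Data.Sum using (_⊎_; inj₁; inj₂)
open import Data.Unit using (⊤; tt)
open import Function.Base using (_∘_)
open import Function.Bundles using (Inverse)
open import Function.Construct.Symmetry using (↔-sym)
open import Relation.Binary.Bundles using (DecSetoid)
open import Relation.Binary.Construct.Closure.Equivalence as Eq using ()
open import Relation.Binary.Construct.Closure.ReflexiveTransitive using (ε; _◅_)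
open import Relation.Binary.Construct.Closure.Symmetric using (fwd; bwd)
open import Relation.Binary.Definitions using (DecidableEquality)
open import Relation.Binary.PropositionalEquality
open import Relation.Nullary
open import Relation.Nullary.Decidable using (_×-dec_; _→-dec_; ¬?; decidable-stable; map′)
open import Relation.Unary using (Decidable)

-- Double counting with sums over lists

module Sums where

  open import Algebra.Properties.CommutativeSemigroup ℕ.+-commutativeSemigroup using (interchange)
  open import Data.Nat using (_+_; _*_; _≤_; _<_; _≤?_; z≤n; s≤s; z<s)
  open import Data.Nat.ListAction using (sum)
  open import Data.Nat.Properties

  𝟙 : {P : Set} → Dec P → ℕ
  𝟙 (yes _) = 1
  𝟙 (no _)  = 0

  𝟙-≤1 : {P : Set} (P? : Dec P) → 𝟙 P? ≤ 1
  𝟙-≤1 (yes _) = ≤-refl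
  𝟙-≤1 (no _)  = z≤n

  𝟙-true : {P : Set} (P? : Dec P) → P → 𝟙 P? ≡ 1
  𝟙-true (yes _) _ = refl
  𝟙-true (no ¬p) p = contradiction p ¬p

  𝟙-false : {P : Set} (P? : Dec P) → ¬ P → 𝟙 P? ≡ 0
  𝟙-false (yes p) ¬p = contradiction p ¬p
  𝟙-false (no _)  _  = refl

  𝟙-mono : {P Q : Set} (P? : Dec P) (Q? : Dec Q) → (P → Q) → 𝟙 P? ≤ 𝟙 Q?
  𝟙-mono (no _)  _  _   = z≤n
  𝟙-mono (yes p) Q? p→q = ≤-reflexive (sym (𝟙-true Q? (p→q p)))

  𝟙-cong : {P Q : Set} (P? : Dec P) (Q? : Dec Q) → (P → Q) → (Q → P) → 𝟙 P? ≡ 𝟙 Q?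
  𝟙-cong P? Q? to from = ≤-antisym (𝟙-mono P? Q? to) (𝟙-mono Q? P? from)

  ∑ : {A : Set} → List A → (A → ℕ) → ℕ
  ∑ xs f = sum (map f xs)

  module _ {A : Set} where

    ∑-mono : ∀ xs {f g : A → ℕ} → (∀ {x} → x ∈ xs → f x ≤ g x) → ∑ xs f ≤ ∑ xs g
    ∑-mono []       _   = z≤n
    ∑-mono (_ ∷ xs) f≤g = +-mono-≤ (f≤g (here refl)) (∑-mono xs (f≤g ∘ there))

    ∑-cong : ∀ xs {f g : A → ℕ} → (∀ {x} → x ∈ xs → f x ≡ g x) → ∑ xs f ≡ ∑ xs g
    ∑-cong []       _   = refl
    ∑-cong (_ ∷ xs) f≡g = cong₂ _+_ (f≡g (here refl)) (∑-cong xs (f≡g ∘ there))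

    ∑-mono-< : ∀ {xs} {f g : A → ℕ} {x} → (∀ {x} → x ∈ xs → f x ≤ g x) →
               x ∈ xs → f x < g x → ∑ xs f < ∑ xs g
    ∑-mono-< {_ ∷ xs} f≤g (here refl) f<g = +-mono-<-≤ f<g (∑-mono xs (f≤g ∘ there))
    ∑-mono-< f≤g (there x∈xs) f<g = +-mono-≤-< (f≤g (here refl)) (∑-mono-< (f≤g ∘ there) x∈xs f<g)

    ∑-const : ∀ (xs : List A) c → ∑ xs (λ _ → c) ≡ length xs * c
    ∑-const []       c = refl
    ∑-const (_ ∷ xs) c = cong (c +_) (∑-const xs c)

    ∑-zero : ∀ xs {f : A → ℕ} → (∀ {x} → x ∈ xs → f x ≡ 0) → ∑ xs f ≡ 0
    ∑-zero xs f≡0 = trans (∑-cong xs f≡0) (trans (∑-const xs 0) (*-zeroʳ (length xs)))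

    ∑-+ : ∀ xs (f g : A → ℕ) → ∑ xs (λ x → f x + g x) ≡ ∑ xs f + ∑ xs g
    ∑-+ []       f g = refl
    ∑-+ (x ∷ xs) f g rewrite ∑-+ xs f g = interchange (f x) (g x) (∑ xs f) (∑ xs g)

    ∑-*ˡ : ∀ xs c (f : A → ℕ) → ∑ xs (λ x → c * f x) ≡ c * ∑ xs f
    ∑-*ˡ []       c f = sym (*-zeroʳ c)
    ∑-*ˡ (x ∷ xs) c f = trans (cong (c * f x +_) (∑-*ˡ xs c f)) (sym (*-distribˡ-+ c (f x) (∑ xs f)))

    ∑-++ : ∀ xs ys (f : A → ℕ) → ∑ (xs ++ ys) f ≡ ∑ xs f + ∑ ys f
    ∑-++ []       ys f = refl
    ∑-++ (x ∷ xs) ys f = trans (cong (f x +_) (∑-++ xs ys f)) (sym (+-assoc (f x) (∑ xs f) (∑ ys f)))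

    ∑-filter : {P : A → Set} (P? : Decidable P) → ∀ xs f → ∑ (filter P? xs) f ≡ ∑ xs (λ x → 𝟙 (P? x) * f x)
    ∑-filter P? []       f = refl
    ∑-filter P? (x ∷ xs) f with P? x
    ... | yes _ = cong₂ _+_ (sym (+-identityʳ (f x))) (∑-filter P? xs f)
    ... | no  _ = ∑-filter P? xs f

    length-∑ : (xs : List A) → length xs ≡ ∑ xs (λ _ → 1)
    length-∑ xs = sym (trans (∑-const xs 1) (*-identityʳ (length xs)))

    length-filter-∑ : {P : A → Set} (P? : Decidable P) → ∀ xs → length (filter P? xs) ≡ ∑ xs (𝟙 ∘ P?)
    length-filter-∑ P? xs = trans (length-∑ (filter P? xs))
      (trans (∑-filter P? xs _) (∑-cong xs (λ {x} _ → *-identityʳ (𝟙 (P? x)))))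

    term≤∑ : ∀ {xs} (f : A → ℕ) {x} → x ∈ xs → f x ≤ ∑ xs f
    term≤∑ {_ ∷ xs} f (here refl)  = m≤m+n _ (∑ xs f)
    term≤∑ {y ∷ _}  f (there x∈xs) = ≤-trans (term≤∑ f x∈xs) (m≤n+m _ (f y))

    two-terms≤∑ : ∀ {xs} (f : A → ℕ) {x y} → x ≢ y → x ∈ xs → y ∈ xs → f x + f y ≤ ∑ xs f
    two-terms≤∑ f x≢y (here refl) (here refl) = contradiction refl x≢y
    two-terms≤∑ f x≢y (here refl) (there y∈)  = +-monoʳ-≤ _ (term≤∑ f y∈)
    two-terms≤∑ {_ ∷ xs} f {x} {y} x≢y (there x∈) (here refl) =
      subst (_≤ f y + ∑ xs f) (+-comm (f y) (f x)) (+-monoʳ-≤ (f y) (term≤∑ f x∈))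
    two-terms≤∑ {z ∷ _} f x≢y (there x∈) (there y∈) = ≤-trans (two-terms≤∑ f x≢y x∈ y∈) (m≤n+m _ (f z))

    ∑-≤-one-term : ∀ {xs} {f : A → ℕ} {c} → Unique xs → (∀ {x} → x ∈ xs → f x ≤ c) →
      (∀ {x y} → x ∈ xs → y ∈ xs → x ≢ y → 0 < f x → 0 < f y → ⊥) → ∑ xs f ≤ c
    ∑-≤-one-term {[]} _ _ _ = z≤n
    ∑-≤-one-term {x ∷ xs} {f} {c} (x∉xs ∷ uniq) f≤c lone with f x in fx
    ... | zero  = ∑-≤-one-term uniq (f≤c ∘ there) (λ y∈ z∈ → lone (there y∈) (there z∈))
    ... | suc k = subst (_≤ c) (trans fx (sym (trans (cong (suc k +_) rest) (+-identityʳ _)))) (f≤c (here refl))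
      where
      rest : ∑ xs f ≡ 0
      rest = ∑-zero xs λ {y} y∈ → n≤0⇒n≡0 (≮⇒≥ (lone (here refl) (there y∈) (All.lookup x∉xs y∈)
               (subst (0 <_) (sym fx) z<s)))

    ∑-≤-two-terms : ∀ {xs} {f : A → ℕ} → Unique xs → (∀ {x} → x ∈ xs → f x ≤ 2) →
      (∀ {x y} → x ∈ xs → y ∈ xs → x ≢ y → 0 < f x → 0 < f y → f x ≤ 1) →
      (∀ {x y z} → x ∈ xs → y ∈ xs → z ∈ xs → x ≢ y → x ≢ z → y ≢ z → 0 < f x → 0 < f y → 0 < f z → ⊥) →
      ∑ xs f ≤ 2
    ∑-≤-two-terms {[]} _ _ _ _ = z≤n
    ∑-≤-two-terms {x ∷ xs} {f} (x∉xs ∷ uniq) f≤2 pair triple with 1 ≤? f x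
    ... | no f≮x = subst (λ n → n + ∑ xs f ≤ 2) (sym (n≤0⇒n≡0 (≮⇒≥ f≮x)))
      (∑-≤-two-terms uniq (f≤2 ∘ there) (λ y∈ z∈ → pair (there y∈) (there z∈))
        (λ w∈ y∈ z∈ → triple (there w∈) (there y∈) (there z∈)))
    ... | yes 0<fx with any? (λ y → 1 ≤? f y) xs
    ...   | no none = subst (λ n → f x + n ≤ 2) (sym (∑-zero xs λ y∈ → n≤0⇒n≡0 (≮⇒≥ (none ∘ lose y∈))))
                        (subst (_≤ 2) (sym (+-identityʳ (f x))) (f≤2 (here refl)))
    ...   | yes some with find some
    ...     | y , y∈ , 0<fy = +-mono-≤ (pair (here refl) (there y∈) (All.lookup x∉xs y∈) 0<fx 0<fy)
                (∑-≤-one-term uniq bound lone)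
      where
      bound : ∀ {z} → z ∈ xs → f z ≤ 1
      bound {z} z∈ with 1 ≤? f z
      ... | yes 0<fz = pair (there z∈) (here refl) (All.lookup x∉xs z∈ ∘ sym) 0<fz 0<fx
      ... | no  f≮z  = ≤-trans (≮⇒≥ f≮z) z≤n
      lone : ∀ {z w} → z ∈ xs → w ∈ xs → z ≢ w → 0 < f z → 0 < f w → ⊥
      lone z∈ w∈ z≢w = triple (here refl) (there z∈) (there w∈)
        (All.lookup x∉xs z∈) (All.lookup x∉xs w∈) z≢w 0<fx

    ∑-single : ∀ {xs} {f : A → ℕ} {x} → Unique xs → x ∈ xs → (∀ {y} → y ≢ x → f y ≡ 0) → ∑ xs f ≡ f x
    ∑-single {f = f} {x} uniq x∈xs others = ≤-antisym
      (∑-≤-one-term uniq bound lone) (term≤∑ f x∈xs)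
      where
      bound : ∀ {y} → y ∈ _ → f y ≤ f x
      bound {y} _ with f y in fy
      ... | zero  = z≤n
      ... | suc k = decidable-stable (suc k ≤? f x) λ ≰ →
        0≢1+n (trans (sym (others λ { refl → ≰ (≤-reflexive (sym fy)) })) fy)
      lone : ∀ {y z} → y ∈ _ → z ∈ _ → y ≢ z → 0 < f y → 0 < f z → ⊥
      lone {y} {z} _ _ y≢z 0<fy 0<fz = <⇒≢ 0<fy (sym (others λ { refl → <⇒≢ 0<fz (sym (others (y≢z ∘ sym))) }))

  ∑-swap : {A B : Set} → ∀ xs ys (f : A → B → ℕ) →
           ∑ xs (λ x → ∑ ys (f x)) ≡ ∑ ys (λ y → ∑ xs (λ x → f x y))
  ∑-swap []       ys f = sym (∑-zero ys λ _ → refl)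
  ∑-swap (x ∷ xs) ys f = trans (cong (∑ ys (f x) +_) (∑-swap xs ys f)) (sym (∑-+ ys (f x) _))

  ∑-map : {A B : Set} (g : A → B) (f : B → ℕ) → ∀ xs → ∑ (map g xs) f ≡ ∑ xs (f ∘ g)
  ∑-map g f []       = refl
  ∑-map g f (x ∷ xs) = cong (f (g x) +_) (∑-map g f xs)

  -- Double count of the pairs with `f x ≡ y`: every `x` occurs in at least one, every `y` in at
  -- most one.
  length-injection : {A B : Set} → DecidableEquality B → ∀ {xs ys} (f : A → B) → Unique xs →
    (∀ {x y} → f x ≡ f y → x ≡ y) → (∀ {x} → x ∈ xs → f x ∈ ys) → length xs ≤ length ys
  length-injection _≟_ {xs} {ys} f uniq inj f∈ = begin
    length xs                                   ≡⟨ length-∑ xs ⟩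
    ∑ xs (λ _ → 1)                              ≤⟨ ∑-mono xs covered ⟩
    ∑ xs (λ x → ∑ ys (λ y → 𝟙 (f x ≟ y)))       ≡⟨ ∑-swap xs ys _ ⟩
    ∑ ys (λ y → ∑ xs (λ x → 𝟙 (f x ≟ y)))       ≤⟨ ∑-mono ys (λ {y} _ →
                                                     ∑-≤-one-term uniq (λ {x} _ → 𝟙-≤1 (f x ≟ y)) (lone y)) ⟩
    ∑ ys (λ _ → 1)                              ≡⟨ sym (length-∑ ys) ⟩
    length ys                                   ∎
    where
    open ≤-Reasoning
    covered : ∀ {x} → x ∈ xs → 1 ≤ ∑ ys (λ y → 𝟙 (f x ≟ y))
    covered {x} x∈ = ≤-trans (≤-reflexive (sym (𝟙-true (f x ≟ f x) refl))) (term≤∑ (λ y → 𝟙 (f x ≟ y)) (f∈ x∈))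
    lone : ∀ y {x z} → x ∈ xs → z ∈ xs → x ≢ z → 0 < 𝟙 (f x ≟ y) → 0 < 𝟙 (f z ≟ y) → ⊥
    lone y {x} {z} _ _ x≢z _ _ with f x ≟ y | f z ≟ y
    ... | yes refl | yes fz≡fx = x≢z (inj (sym fz≡fx))
    lone y _ _ _ () _ | no _ | _
    lone y _ _ _ _ () | yes _ | no _

  -- For the darts xs leaving a vertex and a set C of darts closed under continuation, I ("in")
  -- stands for the darts whose reverse is in C and O ("out") for those in C themselves.
  module _ {A : Set} (_≟_ : DecidableEquality A) {xs : List A} (uniq : Unique xs) {W I O : A → Set} (I? : Decidable I) (O? : Decidable O) (I⊆W : ∀ {x} → I x → W x) (spread : ∀ {x y} → x ∈ xs → y ∈ xs → I x → W y → y ≢ x → O y) where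

    private
      in-out : ∀ x → (∀ {y} → y ∈ xs → y ≢ x → ¬ I y) ⊎ (∃ λ y → y ∈ xs × y ≢ x × I y)
      in-out x with any? (λ y → ¬? (y ≟ x) ×-dec I? y) xs
      ... | yes some = inj₂ (find some)
      ... | no none  = inj₁ λ y∈ y≢x Iy → none (lose y∈ (y≢x , Iy))

      ∑I-≤1 : ∀ {x} → I x → (∀ {y} → y ∈ xs → y ≢ x → ¬ I y) → ∑ xs (𝟙 ∘ I?) ≤ 1
      ∑I-≤1 {x} Ix only = ∑-≤-one-term uniq (λ {y} _ → 𝟙-≤1 (I? y)) lone
        where
        lone : ∀ {y z} → y ∈ xs → z ∈ xs → y ≢ z → 0 < 𝟙 (I? y) → 0 < 𝟙 (I? z) → ⊥
        lone {y} {z} y∈ z∈ y≢z _ _ with I? y | I? z | y ≟ x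
        ... | yes Iy | _      | no y≢x   = only y∈ y≢x Iy
        ... | yes _  | yes Iz | yes refl = only z∈ (y≢z ∘ sym) Iz
        lone _ _ _ () _ | no _ | _ | _
        lone _ _ _ _ () | yes _ | no _ | _

      all-out : ∀ {x y} → x ∈ xs → y ∈ xs → I x → I y → y ≢ x → ∀ {z} → z ∈ xs → W z → O z
      all-out {x} x∈ y∈ Ix Iy y≢x {z} z∈ Wz with z ≟ x
      ... | yes refl = spread y∈ z∈ Iy Wz (y≢x ∘ sym)
      ... | no z≢x   = spread x∈ z∈ Ix Wz z≢x

    -- Two distinct in-darts turn every dart of `W` at the vertex into an out-dart; a lone in-dart
    -- is matched by the dart that continues it.
    ∑I≤∑O : (∀ {x} → x ∈ xs → I x → ∃ λ y → y ∈ xs × W y × y ≢ x) → ∑ xs (𝟙 ∘ I?) ≤ ∑ xs (𝟙 ∘ O?)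
    ∑I≤∑O continue with any? I? xs
    ... | no none = subst (_≤ _) (sym (∑-zero xs λ {x} x∈ → 𝟙-false (I? x) (none ∘ lose x∈))) z≤n
    ... | yes some with find some
    ...   | x , x∈ , Ix with in-out x
    ...     | inj₂ (y , y∈ , y≢x , Iy) = ∑-mono xs λ {z} z∈ → 𝟙-mono (I? z) (O? z)
                (all-out x∈ y∈ Ix Iy y≢x z∈ ∘ I⊆W)
    ...     | inj₁ only with continue x∈ Ix
    ...       | y , y∈ , Wy , y≢x = ≤-trans (∑I-≤1 Ix only)
                  (≤-trans (≤-reflexive (sym (𝟙-true (O? y) (spread x∈ y∈ Ix Wy y≢x)))) (term≤∑ (𝟙 ∘ O?) y∈))

    -- With two in-darts, all in-darts are out and `a` is out without being in. With a lone in-dart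
    -- `x`, both `a` and one of `b`, `c` different from `x` are out. With none, `a` suffices.
    ∑I<∑O : ∀ {a b c} → a ∈ xs → b ∈ xs → c ∈ xs → a ≢ b → a ≢ c → b ≢ c → W b → W c → ¬ I a → O a →
            ∑ xs (𝟙 ∘ I?) < ∑ xs (𝟙 ∘ O?)
    ∑I<∑O {a} {b} {c} a∈ b∈ c∈ a≢b a≢c b≢c Wb Wc ¬Ia Oa with any? I? xs
    ... | no none = subst (_< _) (sym (∑-zero xs λ {x} x∈ → 𝟙-false (I? x) (none ∘ lose x∈)))
                      (≤-trans (≤-reflexive (sym (𝟙-true (O? a) Oa))) (term≤∑ (𝟙 ∘ O?) a∈))
    ... | yes some with find some
    ...   | x , x∈ , Ix with in-out x
    ...     | inj₂ (y , y∈ , y≢x , Iy) = ∑-mono-<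
                (λ {z} z∈ → 𝟙-mono (I? z) (O? z) (all-out x∈ y∈ Ix Iy y≢x z∈ ∘ I⊆W)) a∈
                (≤-reflexive (trans (cong suc (𝟙-false (I? a) ¬Ia)) (sym (𝟙-true (O? a) Oa))))
    ...     | inj₁ only = ≤-trans (s≤s (∑I-≤1 Ix only)) two-out
      where
      two : ∀ {y} → a ≢ y → y ∈ xs → O y → 2 ≤ ∑ xs (𝟙 ∘ O?)
      two {y} a≢y y∈ Oy = subst (_≤ ∑ xs (𝟙 ∘ O?)) (cong₂ _+_ (𝟙-true (O? a) Oa) (𝟙-true (O? y) Oy))
                            (two-terms≤∑ (𝟙 ∘ O?) a≢y a∈ y∈)
      two-out : 2 ≤ ∑ xs (𝟙 ∘ O?)
      two-out with b ≟ x
      ... | no b≢x   = two a≢b b∈ (spread x∈ b∈ Ix Wb b≢x)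
      ... | yes refl = two a≢c c∈ (spread x∈ c∈ Ix Wc (b≢c ∘ sym))

  -- Decisions over finite sets and stabilising chains

  module _ {A : Set} {xs : List A} (complete : ∀ a → a ∈ xs) where

    ∃? : {P : A → Set} → Decidable P → Dec (∃ P)
    ∃? P? = map′ (λ some → let x , _ , Px = find some in x , Px) (λ (x , Px) → lose (complete x) Px) (any? P? xs)

    ∀? : {P : A → Set} → Decidable P → Dec (∀ x → P x)
    ∀? P? = map′ (λ all x → All.lookup all (complete x)) (λ all → All.tabulate λ {x} _ → all x) (all? P? xs)

    ¬∀⇒∃¬ : {P : A → Set} → Decidable P → ¬ (∀ x → P x) → ∃ λ x → ¬ P x
    ¬∀⇒∃¬ P? ¬all = decidable-stable (∃? (¬? ∘ P?)) λ none →
      ¬all λ x → decidable-stable (P? x) λ ¬Px → none (x , ¬Px)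

    -- By step, a chain that is stationary once stays so; until then it loses an element each time.
    module _ {P : ℕ → A → Set} (P? : ∀ n → Decidable (P n)) (decreasing : ∀ n {x} → P (suc n) x → P n x) (step : ∀ n → (∀ {x} → P n x → P (suc n) x) → ∀ {x} → P (suc n) x → P (suc (suc n)) x) where

      private
        stable-or-small : ∀ n → (∀ {x} → P n x → P (suc n) x) ⊎ (∑ xs (𝟙 ∘ P? n) + n ≤ length xs)
        stable-or-small zero = inj₂ (subst₂ _≤_ (sym (+-identityʳ _)) (sym (length-∑ xs))
          (∑-mono xs λ {x} _ → 𝟙-≤1 (P? 0 x)))
        stable-or-small (suc n) with stable-or-small n
        ... | inj₁ stable = inj₁ (step n stable)
        ... | inj₂ small with ∀? (λ x → P? n x →-dec P? (suc n) x)
        ...   | yes stable = inj₁ (step n (λ {x} → stable x))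
        ...   | no ¬stable = inj₂ (≤-trans (≤-reflexive (+-suc _ n)) (≤-trans (+-monoˡ-≤ n fewer) small))
          where
          fewer : ∑ xs (𝟙 ∘ P? (suc n)) < ∑ xs (𝟙 ∘ P? n)
          fewer with ¬∀⇒∃¬ (λ x → P? n x →-dec P? (suc n) x) ¬stable
          ... | x , ¬step with P? n x | P? (suc n) x
          ...   | _      | yes p = contradiction (λ _ → p) ¬step
          ...   | no ¬p  | no _  = contradiction (λ p → contradiction p ¬p) ¬step
          ...   | yes p  | no ¬q = ∑-mono-< (λ {y} _ → 𝟙-mono (P? (suc n) y) (P? n y) (decreasing n)) (complete x)
                    (≤-reflexive (trans (cong suc (𝟙-false (P? (suc n) x) ¬q)) (sym (𝟙-true (P? n x) p))))

      chain-stable : ∀ {n} → length xs ≤ n → ∀ {x} → P n x → P (suc n) x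
      chain-stable {n} len≤n {x} Pnx with stable-or-small n
      ... | inj₁ stable = stable Pnx
      -- The element `x` is itself counted, so `1 + n` would be at most `length xs`.
      ... | inj₂ small  = contradiction
        (≤-trans (+-monoˡ-≤ n (≤-trans (≤-reflexive (sym (𝟙-true (P? n x) Pnx))) (term≤∑ (𝟙 ∘ P? n) (complete x)))) (≤-trans small len≤n))
        1+n≰n

open Sums

open import Data.Integer using (ℤ; +_; -[1+_]; 0ℤ; 1ℤ; -1ℤ; -≤-; -≤+; +≤+; _+_; _-_; _*_; _≤_; _⊔_)
import Data.Integer as ℤ
import Data.Integer.Properties as ℤₚ
open import Data.Integer.Tactic.RingSolver using (solve-∀)

-- Lists, finite sets and integer inequalities

length-cartesianProduct : {A B : Set} (xs : List A) (ys : List B) →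
                          length (cartesianProduct xs ys) ≡ length xs ℕ.* length ys
length-cartesianProduct []       ys = refl
length-cartesianProduct (x ∷ xs) ys = trans (length-++ (map (x ,_) ys))
  (cong₂ ℕ._+_ (length-map (x ,_) ys) (length-cartesianProduct xs ys))

allPairs-lookup : {A : Set} {_~_ : A → A → Set} → (∀ {x y} → x ~ y → y ~ x) → ∀ {xs x y} →
                  AllPairs _~_ xs → x ∈ xs → y ∈ xs → x ≢ y → x ~ y
allPairs-lookup ~-sym _        (here refl) (here refl) x≢y = contradiction refl x≢y
allPairs-lookup ~-sym (p ∷ _)  (here refl) (there y∈)  _   = All.lookup p y∈
allPairs-lookup ~-sym (p ∷ _)  (there x∈)  (here refl) _   = ~-sym (All.lookup p x∈)
allPairs-lookup ~-sym (_ ∷ ps) (there x∈)  (there y∈)  x≢y = allPairs-lookup ~-sym ps x∈ y∈ x≢y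

elements-unique : {A : Set} (fin : Finite A) → Unique (elements fin)
elements-unique (n , A↔n) = Unique.map⁺ from-injective (Unique.allFin⁺ n)
  where
  open Inverse A↔n
  from-injective : ∀ {i j} → from i ≡ from j → i ≡ j
  from-injective {i} {j} eq = trans (sym (strictlyInverseˡ i)) (trans (cong to eq) (strictlyInverseˡ j))

-- An infinite chain in a finite set repeats an element, and transitivity contracts the stretch
-- between two occurrences to one step.
serial-transitive⇒loop : {A : Set} → Finite A → {B : A → Set} {_≻_ : A → A → Set} →
  (∀ {x} → B x → ∃ λ y → B y × x ≻ y) → (∀ {x y z} → B x → B y → B z → x ≻ y → y ≻ z → x ≻ z) →
  ∃ B → ∃ λ x → B x × x ≻ x
serial-transitive⇒loop {A} (n , A↔n) {B} {_≻_} serial transitive start = loop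
  where
  open Inverse A↔n
  chain : ℕ → ∃ B
  chain zero    = start
  chain (suc k) = let y , By , _ = serial (proj₂ (chain k)) in y , By
  descends : ∀ i k → proj₁ (chain i) ≻ proj₁ (chain (suc (k ℕ.+ i)))
  descends i zero    = proj₂ (proj₂ (serial (proj₂ (chain i))))
  descends i (suc k) = transitive (proj₂ (chain i)) (proj₂ (chain (suc (k ℕ.+ i)))) (proj₂ (chain (suc (suc (k ℕ.+ i)))))
    (descends i k) (proj₂ (proj₂ (serial (proj₂ (chain (suc (k ℕ.+ i)))))))
  loop : ∃ λ x → B x × x ≻ x
  loop with pigeonhole (ℕ.n<1+n n) (λ i → to (proj₁ (chain (toℕ i))))
  ... | i , j , i<j , eq = proj₁ (chain (toℕ i)) , proj₂ (chain (toℕ i)) ,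
    subst (proj₁ (chain (toℕ i)) ≻_)
      (sym (trans (sym (strictlyInverseʳ _)) (trans (cong from eq)
        (trans (strictlyInverseʳ _) (cong (λ k → proj₁ (chain k)) (sym gap))))))
      (descends (toℕ i) (toℕ j ℕ.∸ suc (toℕ i)))
    where
    gap : suc (toℕ j ℕ.∸ suc (toℕ i) ℕ.+ toℕ i) ≡ toℕ j
    gap = trans (sym (ℕ.+-suc _ (toℕ i))) (ℕ.m∸n+n≡m i<j)

-- Writing the difference of the two sides as a sum of known nonnegative differences leaves an
-- identity for the ring solver.
≤-by₁ : ∀ {a b u v} → a ≤ b → v - u ≡ b - a → u ≤ v
≤-by₁ a≤b eq = ℤₚ.0≤i-j⇒j≤i (subst (0ℤ ≤_) (sym eq) (ℤₚ.i≤j⇒0≤j-i a≤b))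

≤-by₂ : ∀ {a b c d u v} → a ≤ b → c ≤ d → v - u ≡ (b - a) + (d - c) → u ≤ v
≤-by₂ a≤b c≤d eq = ℤₚ.0≤i-j⇒j≤i (subst (0ℤ ≤_) (sym eq)
  (ℤₚ.+-mono-≤ (ℤₚ.i≤j⇒0≤j-i a≤b) (ℤₚ.i≤j⇒0≤j-i c≤d)))

≤-by₃ : ∀ {a b c d e f u v} → a ≤ b → c ≤ d → e ≤ f → v - u ≡ (b - a) + (d - c) + (f - e) → u ≤ v
≤-by₃ a≤b c≤d e≤f eq = ℤₚ.0≤i-j⇒j≤i (subst (0ℤ ≤_) (sym eq)
  (ℤₚ.+-mono-≤ (ℤₚ.+-mono-≤ (ℤₚ.i≤j⇒0≤j-i a≤b) (ℤₚ.i≤j⇒0≤j-i c≤d)) (ℤₚ.i≤j⇒0≤j-i e≤f)))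

sign : ∀ i → i ≤ -1ℤ ⊎ 0ℤ ≤ i
sign (+ n)    = inj₂ (+≤+ ℕ.z≤n)
sign -[1+ n ] = inj₁ (-≤- ℕ.z≤n)

-- Halved comparison signs and the four kinds of darts

σ′ : {P : Set} → Dec P → ℤ
σ′ (yes _) = -1ℤ
σ′ (no _)  = 0ℤ

abstract
  -- This is `(t - 1) / 2` for the sign `t` of the comparison, `-1` if `m < n` and `1` otherwise.
  σ : ℕ → ℕ → ℤ
  σ m n = σ′ (m ℕ.<? n)

  σ-antisym : ∀ {m n} → m ≢ n → σ n m ≡ -1ℤ - σ m n
  σ-antisym {m} {n} m≢n with m ℕ.<? n | n ℕ.<? m
  ... | yes m<n | yes n<m = contradiction n<m (ℕ.<-asym m<n)
  ... | yes _   | no _    = refl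
  ... | no _    | yes _   = refl
  ... | no m≮n  | no n≮m  = contradiction (ℕ.≤-antisym (ℕ.≮⇒≥ n≮m) (ℕ.≮⇒≥ m≮n)) m≢n

  -- Whenever `l < n`, at least one of `l < m` and `m < n` holds.
  σ-triangle : ∀ l m n → σ l m + σ m n ≤ σ l n
  σ-triangle l m n with l ℕ.<? m | m ℕ.<? n | l ℕ.<? n
  ... | yes _   | yes _   | yes _   = -≤- ℕ.z≤n
  ... | yes _   | yes _   | no _    = -≤+
  ... | yes _   | no _    | yes _   = ℤₚ.≤-refl
  ... | yes _   | no _    | no _    = -≤+
  ... | no _    | yes _   | yes _   = ℤₚ.≤-refl
  ... | no _    | yes _   | no _    = -≤+
  ... | no l≮m  | no m≮n  | yes l<n = contradiction (ℕ.<-≤-trans l<n (ℕ.≤-trans (ℕ.≮⇒≥ m≮n) (ℕ.≮⇒≥ l≮m))) (ℕ.<-irrefl refl)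
  ... | no _    | no _    | no _    = ℤₚ.≤-refl

rank : Bool → Colour → ℕ
rank true  zero       = 0
rank true  (suc zero) = 1
rank false zero       = 2
rank false (suc zero) = 3

rank-injective : ∀ b c b′ c′ → rank b c ≡ rank b′ c′ → b ≡ b′ × c ≡ c′
rank-injective true  zero       true  zero       _ = refl , refl
rank-injective true  (suc zero) true  (suc zero) _ = refl , refl
rank-injective false zero       false zero       _ = refl , refl
rank-injective false (suc zero) false (suc zero) _ = refl , refl
rank-injective true  zero       true  (suc zero) ()
rank-injective true  zero       false zero       ()
rank-injective true  zero       false (suc zero) ()
rank-injective true  (suc zero) true  zero       ()
rank-injective true  (suc zero) false zero       ()
rank-injective true  (suc zero) false (suc zero) ()
rank-injective false zero       true  zero       ()
rank-injective false zero       true  (suc zero) ()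
rank-injective false zero       false (suc zero) ()
rank-injective false (suc zero) true  zero       ()
rank-injective false (suc zero) true  (suc zero) ()
rank-injective false (suc zero) false zero       ()

foldr-≤-∑ : {A : Set} {f : A → ℤ} {g : A → ℕ} → (∀ x → f x ≤ + g x) →
            ∀ xs → foldr _+_ 0ℤ (map f xs) ≤ + ∑ xs g
foldr-≤-∑ f≤g []       = +≤+ ℕ.z≤n
foldr-≤-∑ f≤g (x ∷ xs) = ℤₚ.+-mono-≤ (f≤g x) (foldr-≤-∑ f≤g xs)

∑-≤-foldr : {A : Set} {f : A → ℤ} {g : A → ℕ} → (∀ x → + g x ≤ f x) →
            ∀ xs → + ∑ xs g ≤ foldr _+_ 0ℤ (map f xs)
∑-≤-foldr g≤f []       = +≤+ ℕ.z≤n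
∑-≤-foldr g≤f (x ∷ xs) = ℤₚ.+-mono-≤ (g≤f x) (∑-≤-foldr g≤f xs)

excess : ∀ m n → + m - + n + 1ℤ - 1ℤ ≡ + m - + n
excess m n = eq (+ m) (+ n)
  where
  eq : ∀ i j → i - j + 1ℤ - 1ℤ ≡ i - j
  eq = solve-∀

-- Darts, turns and crossings in an étale bigraph

module Walks (K : Bigraph) (étale : Étale K) where
  open Bigraph K public
  open Étale étale

  -- The direction true is from tail to head.
  Dart : Set
  Dart = E × Bool

  _≟ᴰ_ : DecidableEquality Dart
  _≟ᴰ_ = ≡-dec (finite⇒≟ finE) Bool._≟_

  _≟ⱽ_ : DecidableEquality V
  _≟ⱽ_ = finite⇒≟ finV

  rev : Dart → Dart
  rev (e , b) = e , not b

  rev-involutive : ∀ x → rev (rev x) ≡ x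
  rev-involutive (e , b) = cong (e ,_) (not-involutive b)

  rev≢ : ∀ x → rev x ≢ x
  rev≢ (_ , true)  ()
  rev≢ (_ , false) ()

  src tgt : Dart → V
  src (e , true)  = tail e
  src (e , false) = head e
  tgt x = src (rev x)

  kind : Dart → ℕ
  kind (e , b) = rank b (colour e)

  -- The étale condition enters here: colour and direction single out at most one dart at a vertex.
  kind-injective : ∀ {x y} → src x ≡ src y → kind x ≡ kind y → x ≡ y
  kind-injective {e , b} {e′ , b′} s k with rank-injective b (colour e) b′ (colour e′) k
  kind-injective {e , true}  s _ | refl , c = cong (_, true) (tail-injective c s)
  kind-injective {e , false} s _ | refl , c = cong (_, false) (head-injective c s)

  turn : Dart → Dart → ℤ
  turn x y = σ (kind (rev x)) (kind y)

  -- This is `(o + 1) / 2` for the orientation term `o`, against `(t - 1) / 2` for turns. A walk has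
  -- one turn more than inner darts, so the shifts add up to the single `-1/2` in `r`.
  cross : Dart → ℤ
  cross (_ , true)  = 1ℤ
  cross (_ , false) = 0ℤ

  Cont : Dart → Dart → Set
  Cont x y = tgt x ≡ src y × y ≢ rev x

  Cont? : ∀ x y → Dec (Cont x y)
  Cont? x y = (tgt x ≟ⱽ src y) ×-dec ¬? (y ≟ᴰ rev x)

  Cont-rev : ∀ {x y} → Cont x y → Cont (rev y) (rev x)
  Cont-rev {x} {y} (s , y≢) = trans (cong src (rev-involutive y)) (sym s) ,
    λ eq → y≢ (trans (sym (rev-involutive y)) (sym eq))

  Cont-at : ∀ {x y} → src x ≡ src y → y ≢ x → Cont (rev x) y
  Cont-at {x} s y≢x = trans (cong src (rev-involutive x)) s , λ eq → y≢x (trans eq (rev-involutive x))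

  turn-rev : ∀ {x y} → Cont x y → turn (rev y) (rev x) ≡ -1ℤ - turn x y
  turn-rev {x} {y} (s , y≢) = trans (cong (λ d → σ (kind d) (kind (rev x))) (rev-involutive y))
    (σ-antisym λ k → y≢ (sym (kind-injective s k)))

  -- Where walks from `x` fork into `y` and `z`, this bounds the turn from `rev y` to `z` by the
  -- difference of the two turns at `x`; it makes the comparison of edges transitive.
  turn-triangle : ∀ x y z → turn x y + turn (rev y) z ≤ turn x z
  turn-triangle x y z = subst (λ d → turn x y + σ (kind d) (kind z) ≤ turn x z) (sym (rev-involutive y))
    (σ-triangle (kind (rev x)) (kind y) (kind z))

  cross-rev : ∀ x → cross (rev x) ≡ 1ℤ - cross x
  cross-rev (_ , true)  = refl
  cross-rev (_ , false) = refl

  0≤cross : ∀ x → 0ℤ ≤ cross x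
  0≤cross (_ , true)  = +≤+ ℕ.z≤n
  0≤cross (_ , false) = ℤₚ.≤-refl

  cross≤1 : ∀ x → cross x ≤ 1ℤ
  cross≤1 (_ , true)  = ℤₚ.≤-refl
  cross≤1 (_ , false) = +≤+ ℕ.z≤n

  -- The walk goes from x to y, and P is required of its inner darts only.  If t is the odd sum of
  -- ±1 terms of the introduction, then r is (t - 1) / 2: in the universal cover the edge y is
  -- smaller than x if r ≤ -1 and larger if 0 ≤ r, and reversing the walk replaces r by -1 - r.
  data Walk (P : Dart → Set) (y : Dart) (x : Dart) (r : ℤ) : Set where
    last : Cont x y → r ≡ turn x y → Walk P y x r
    step : ∀ {z s} → Cont x z → P z → Walk P y z s → r ≡ turn x z + (cross z + s) → Walk P y x r

  -- A walk all of whose darts are smaller than an earlier dart, from which the sum up to and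
  -- including the crossing of x is s.
  data Fall (P : Dart → Set) (y : Dart) (x : Dart) (s r : ℤ) : Set where
    last : Cont x y → r ≡ s + turn x y → r ≤ -1ℤ → Fall P y x s r
    step : ∀ {z} → Cont x z → P z → s + turn x z ≤ -1ℤ →
           Fall P y z (s + turn x z + cross z) r → Fall P y x s r

  -- A walk to y on which y is larger than every dart before it.
  data Rise (P : Dart → Set) (y : Dart) (x : Dart) (r : ℤ) : Set where
    last : Cont x y → r ≡ turn x y → 0ℤ ≤ r → Rise P y x r
    step : ∀ {z s} → Cont x z → P z → r ≡ turn x z + (cross z + s) → 0ℤ ≤ r → Rise P y z s → Rise P y x r

  -- A fall of `n` darts with its end, its total and the set `P` forgotten, which makes it
  -- decidable.
  Down : ℕ → ℤ → Dart → Set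
  Down zero    s x = ⊤
  Down (suc n) s x = ∃ λ y → Cont x y × s + turn x y ≤ -1ℤ × Down n (s + turn x y + cross y) y

  -- Falls, rises and the largest dart of a walk

  module _ {P : Dart → Set} where

    fall⇒walk : ∀ {x y s r} → Fall P y x s r → Walk P y x (r - s)
    fall⇒walk {x} {y} {s} (last c refl _) = last c (solve-eq s (turn x y))
      where
      solve-eq : ∀ s t → s + t - s ≡ t
      solve-eq = solve-∀
    fall⇒walk {x} {s = s} {r} (step {z} c Pz _ w) = step c Pz (fall⇒walk w) (eq s r (turn x z) (cross z))
      where
      eq : ∀ s r t o → r - s ≡ t + (o + (r - (s + t + o)))
      eq = solve-∀

    rise⇒walk : ∀ {x y r} → Rise P y x r → Walk P y x r
    rise⇒walk (last c eq _)      = last c eq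
    rise⇒walk (step c Pz eq _ w) = step c Pz (rise⇒walk w) eq

    fall-≤ : ∀ {x y s r} → Fall P y x s r → r ≤ -1ℤ
    fall-≤ (last _ _ r≤-1) = r≤-1
    fall-≤ (step _ _ _ w)  = fall-≤ w

    rise-≥ : ∀ {x y r} → Rise P y x r → 0ℤ ≤ r
    rise-≥ (last _ _ 0≤r)     = 0≤r
    rise-≥ (step _ _ _ 0≤r _) = 0≤r

    fall-mono : ∀ {x y s s′ r} → s′ ≤ s → Fall P y x s r → Fall P y x s′ (r + (s′ - s))
    fall-mono {x} {y} {s} {s′} s′≤s (last c refl r≤-1) =
      last c (eq s s′ (turn x y)) (≤-by₂ r≤-1 s′≤s (eq′ s s′ (turn x y)))
      where
      eq : ∀ s s′ t → s + t + (s′ - s) ≡ s′ + t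
      eq = solve-∀
      eq′ : ∀ s s′ t → -1ℤ - (s + t + (s′ - s)) ≡ -1ℤ - (s + t) + (s - s′)
      eq′ = solve-∀
    fall-mono {x} {s = s} {s′} {r} s′≤s (step {z} c Pz neg w) =
      step c Pz (≤-by₂ neg s′≤s (eq s s′ (turn x z)))
        (subst (Fall P _ z _) (eq′ s s′ r (turn x z) (cross z))
          (fall-mono (≤-by₁ s′≤s (eq″ s s′ (turn x z) (cross z))) w))
      where
      eq : ∀ s s′ t → -1ℤ - (s′ + t) ≡ -1ℤ - (s + t) + (s - s′)
      eq = solve-∀
      eq′ : ∀ s s′ r t o → r + (s′ + t + o - (s + t + o)) ≡ r + (s′ - s)
      eq′ = solve-∀
      eq″ : ∀ s s′ t o → s + t + o - (s′ + t + o) ≡ s - s′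
      eq″ = solve-∀

    fall-append : ∀ {x z y s r r′} → Fall P z x s r → P z → Fall P y z (r + cross z) r′ → Fall P y x s r′
    fall-append (last c refl neg)  Pz w′ = step c Pz neg w′
    fall-append (step c Py neg w) Pz w′ = step c Py neg (fall-append w Pz w′)

    -- The end of a rise exceeds all darts before it, so once the end lies below the reference dart,
    -- the whole rise does.
    climb : ∀ {z y s q} → Rise P y z q → s + q ≤ -1ℤ → Fall P y z s (s + q)
    climb-step : ∀ {x z y s q} → Cont x z → P z → Rise P y z q → s + (turn x z + (cross z + q)) ≤ -1ℤ →
                 Fall P y x s (s + (turn x z + (cross z + q)))
    climb (last c refl _)        neg = last c refl neg
    climb (step c Pz refl _ w)   neg = climb-step c Pz w neg
    climb-step {x} {z} {y} {s} {q} c Pz w neg = step c Pz low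
      (subst (Fall P y z _) (assoc s (turn x z) (cross z) q)
        (climb w (subst (_≤ -1ℤ) (sym (assoc s (turn x z) (cross z) q)) neg)))
      where
      eq : ∀ s t o q → -1ℤ - (s + t) ≡ (-1ℤ - (s + (t + (o + q)))) + (o - 0ℤ) + (q - 0ℤ)
      eq = solve-∀
      low : s + turn x z ≤ -1ℤ
      low = ≤-by₃ neg (0≤cross z) (rise-≥ w) (eq s (turn x z) (cross z) q)
      assoc : ∀ s t o q → s + t + o + q ≡ s + (t + (o + q))
      assoc = solve-∀

    -- The end `y` lies above the reference dart of the fall, which in turn lies above every dart of
    -- the fall.
    fall-rise : ∀ {x z y s r q} → s ≤ 0ℤ → Fall P z x s r → P z → Rise P y z q → 0ℤ ≤ r + (cross z + q) →
                Rise P y x (r - s + (cross z + q))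
    fall-rise {x} {z} {s = s} {q = q} s≤0 (last c refl _) Pz w 0≤ =
      step c Pz (eq s (turn x z) (cross z) q) (≤-by₂ 0≤ s≤0 (eq′ s (turn x z) (cross z) q)) w
      where
      eq : ∀ s t o q → s + t - s + (o + q) ≡ t + (o + q)
      eq = solve-∀
      eq′ : ∀ s t o q → s + t - s + (o + q) - 0ℤ ≡ (s + t + (o + q) - 0ℤ) + (0ℤ - s)
      eq′ = solve-∀
    fall-rise {x} {z} {s = s} {r} {q} s≤0 (step {y} c Py neg w) Pz w′ 0≤ =
      step c Py (eq s r (turn x y) (cross y) (cross z) q) (≤-by₂ 0≤ s≤0 (eq′ s r (cross z) q))
        (fall-rise (≤-by₂ neg (cross≤1 y) (eq″ s (turn x y) (cross y))) w Pz w′ 0≤)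
      where
      eq : ∀ s r t o o′ q → r - s + (o′ + q) ≡ t + (o + (r - (s + t + o) + (o′ + q)))
      eq = solve-∀
      eq′ : ∀ s r o′ q → r - s + (o′ + q) - 0ℤ ≡ (r + (o′ + q) - 0ℤ) + (0ℤ - s)
      eq′ = solve-∀
      eq″ : ∀ s t o → 0ℤ - (s + t + o) ≡ (-1ℤ - (s + t)) + (1ℤ - o)
      eq″ = solve-∀

    -- Induction along the walk, comparing `x` with the largest dart of the rest. The largest dart
    -- of the whole is its start, its end or an inner dart `z`.
    maximum : ∀ {x y r} → Walk P y x r →
      ∃ (Fall P y x 0ℤ) ⊎ ∃ (Rise P y x) ⊎ ∃ λ z → P z × ∃ (Rise P z x) × ∃ (Fall P y z 0ℤ)
    maximum {x} {y} (last c refl) with sign (turn x y)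
    ... | inj₁ neg = inj₁ (_ , last c (sym (ℤₚ.+-identityˡ _)) neg)
    ... | inj₂ pos = inj₂ (inj₁ (_ , last c refl pos))
    maximum {x} {y} (step {z} c Pz w _) with maximum w
    ... | inj₁ (r , f) with sign (turn x z)
    ...   | inj₁ neg = inj₁ (_ , step c Pz neg′ (fall-mono below f))
      where
      neg′ : 0ℤ + turn x z ≤ -1ℤ
      neg′ = subst (_≤ -1ℤ) (sym (ℤₚ.+-identityˡ _)) neg
      eq : ∀ t o → 0ℤ - (0ℤ + t + o) ≡ (-1ℤ - t) + (1ℤ - o)
      eq = solve-∀
      below : 0ℤ + turn x z + cross z ≤ 0ℤ
      below = ≤-by₂ neg (cross≤1 z) (eq (turn x z) (cross z))
    ...   | inj₂ pos = inj₂ (inj₂ (z , Pz , (_ , last c refl pos) , (_ , f)))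
    maximum {x} {y} (step {z} c Pz w _) | inj₂ (inj₁ (q , ρ)) with sign (turn x z + (cross z + q))
    ... | inj₁ neg = inj₁ (_ , climb-step c Pz ρ (subst (_≤ -1ℤ) (sym (ℤₚ.+-identityˡ _)) neg))
    ... | inj₂ pos = inj₂ (inj₁ (_ , step c Pz refl pos ρ))
    maximum {x} {y} (step {z} c Pz w _) | inj₂ (inj₂ (m , Pm , (q , ρ) , (r , f)))
      with sign (turn x z + (cross z + q))
    ... | inj₂ pos = inj₂ (inj₂ (m , Pm , (_ , step c Pz refl pos ρ) , (r , f)))
    ... | inj₁ neg = inj₁ (_ , fall-append (climb-step c Pz ρ neg′) Pm (fall-mono (≤-by₂ neg′ (cross≤1 m)
                       (eq (0ℤ + (turn x z + (cross z + q))) (cross m))) f))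
      where
      neg′ : 0ℤ + (turn x z + (cross z + q)) ≤ -1ℤ
      neg′ = subst (_≤ -1ℤ) (sym (ℤₚ.+-identityˡ _)) neg
      eq : ∀ s o → 0ℤ - (s + o) ≡ (-1ℤ - s) + (1ℤ - o)
      eq = solve-∀

  -- Descents of bounded and of unbounded length

  down-mono : ∀ n {s s′ x} → s′ ≤ s → Down n s x → Down n s′ x
  down-mono zero s′≤s _ = tt
  down-mono (suc n) {s} {s′} {x} s′≤s (y , c , neg , d) =
    y , c , ≤-by₂ neg s′≤s (eq s s′ (turn x y)) , down-mono n (≤-by₁ s′≤s (eq′ s s′ (turn x y) (cross y))) d
    where
    eq : ∀ s s′ t → -1ℤ - (s′ + t) ≡ -1ℤ - (s + t) + (s - s′)
    eq = solve-∀
    eq′ : ∀ s s′ t o → s + t + o - (s′ + t + o) ≡ s - s′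
    eq′ = solve-∀

  down-pred : ∀ n {s x} → Down (suc n) s x → Down n s x
  down-pred zero    _                 = tt
  down-pred (suc n) (y , c , neg , d) = y , c , neg , down-pred n d

  -- An infinite descent in finite approximations; those for different `n` need not extend one
  -- another.
  Good : Dart → Set
  Good x = ∀ n → Down n 0ℤ x

  module _ {P : Dart → Set} where

    fall-down : ∀ n {x y s r} → Fall P y x s r → Down n (r + cross y) y → Down (suc n) s x
    fall-down n (last c refl neg)  d = _ , c , neg , d
    fall-down n {x} {s = s} (step c _ neg w) d = down-pred (suc n) {s} {x} (_ , c , neg , fall-down n w d)

    private
      -- As `y` lies below the reference dart, whatever stays below `y` does too; the gap of 1
      -- absorbs the crossing of `y`.
      reset : ∀ n {x y s r} → Fall P y x s r → Down n 0ℤ y → Down n (r + cross y) y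
      reset n {y = y} {r = r} w = down-mono n (≤-by₂ (fall-≤ w) (cross≤1 y) (eq r (cross y)))
        where
        eq : ∀ r o → 0ℤ - (r + o) ≡ (-1ℤ - r) + (1ℤ - o)
        eq = solve-∀

    fall-good : ∀ {x y r} → Fall P y x 0ℤ r → Good y → Good x
    fall-good w good zero    = tt
    fall-good w good (suc n) = fall-down n w (reset n w (good n))

    -- The closed walk is run through again and again: every lap returns to `x` at a smaller edge of
    -- the universal cover.
    fall-periodic : ∀ {x r} → Fall P x x 0ℤ r → Good x
    fall-periodic w zero    = tt
    fall-periodic w (suc n) = fall-down n w (reset n w (fall-periodic w n))

    -- Read backwards, a rise falls from `rev y`: its sums `r` become `-1 - r`, so `0 ≤ r` turns
    -- into negativity.
    rise-down : ∀ n {x y r} → Rise P y x r → Down n (-1ℤ - r + cross (rev x)) (rev x) → Down (suc n) 0ℤ (rev y)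
    rise-down n {x} {y} {r} (last c refl 0≤r) d = rev x , Cont-rev c , neg , subst (λ s → Down n s (rev x)) eq d
      where
      turn≡ : 0ℤ + turn (rev y) (rev x) ≡ -1ℤ - turn x y
      turn≡ = trans (ℤₚ.+-identityˡ _) (turn-rev c)
      neg : 0ℤ + turn (rev y) (rev x) ≤ -1ℤ
      neg = subst (_≤ -1ℤ) (sym turn≡) (≤-by₁ 0≤r (id₁ (turn x y)))
        where
        id₁ : ∀ t → -1ℤ - (-1ℤ - t) ≡ t - 0ℤ
        id₁ = solve-∀
      eq : -1ℤ - turn x y + cross (rev x) ≡ 0ℤ + turn (rev y) (rev x) + cross (rev x)
      eq = cong (_+ cross (rev x)) (sym turn≡)
    rise-down n {x} {y} {r} (step {z} {s} c _ refl 0≤r w) d =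
      down-pred (suc n) {0ℤ} {rev y} (rise-down (suc n) w (rev x , Cont-rev c , neg , subst (λ s → Down n s (rev x)) eq d))
      where
      sum≡ : -1ℤ - s + cross (rev z) + turn (rev z) (rev x) ≡ -1ℤ - (turn x z + (cross z + s))
      sum≡ rewrite turn-rev c | cross-rev z = id₁ (turn x z) (cross z) s
        where
        id₁ : ∀ t o s → -1ℤ - s + (1ℤ - o) + (-1ℤ - t) ≡ -1ℤ - (t + (o + s))
        id₁ = solve-∀
      neg : -1ℤ - s + cross (rev z) + turn (rev z) (rev x) ≤ -1ℤ
      neg = subst (_≤ -1ℤ) (sym sum≡) (≤-by₁ 0≤r (id₂ (turn x z + (cross z + s))))
        where
        id₂ : ∀ t → -1ℤ - (-1ℤ - t) ≡ t - 0ℤ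
        id₂ = solve-∀
      eq : -1ℤ - (turn x z + (cross z + s)) + cross (rev x) ≡
           -1ℤ - s + cross (rev z) + turn (rev z) (rev x) + cross (rev x)
      eq = cong (_+ cross (rev x)) (sym sum≡)

    private
      reset′ : ∀ n {x y r} → Rise P y x r → Down n 0ℤ (rev x) → Down n (-1ℤ - r + cross (rev x)) (rev x)
      reset′ n {x} {r = r} w = down-mono n (≤-by₂ (rise-≥ w) (cross≤1 (rev x)) (eq r (cross (rev x))))
        where
        eq : ∀ r o → 0ℤ - (-1ℤ - r + o) ≡ (r - 0ℤ) + (1ℤ - o)
        eq = solve-∀

    rise-good : ∀ {x y r} → Rise P y x r → Good (rev x) → Good (rev y)
    rise-good w good zero    = tt
    rise-good w good (suc n) = rise-down n w (reset′ n w (good n))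

    rise-periodic : ∀ {x r} → Rise P x x r → Good (rev x)
    rise-periodic w zero    = tt
    rise-periodic w (suc n) = rise-down n w (reset′ n w (rise-periodic w n))

    -- The largest edge of a bi-infinite line whose two ends stay below good darts.
    peak : ∀ {x y r} → P x → P y → Walk P y x r → Good (rev x) → Good y → ∃ λ z → P z × Good z × Good (rev z)
    peak {x} {y} Px Py w good good′ with maximum w
    ... | inj₁ (_ , f)                             = x , Px , fall-good f good′ , good
    ... | inj₂ (inj₁ (_ , ρ))                      = y , Py , good′ , rise-good ρ good
    ... | inj₂ (inj₂ (z , Pz , (_ , ρ) , (_ , f))) = z , Pz , fall-good f good′ , rise-good ρ good

    -- A closed walk runs downhill from its largest dart in one of its two directions.
    cycle-maximum : ∀ {x r} → P x → Walk P x x r →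
      ∃ λ z → (z ≡ x ⊎ ∃ (Walk P z x) × ∃ (Walk P x z)) × P z × (Good z ⊎ Good (rev z))
    cycle-maximum {x} Px w with maximum w
    ... | inj₁ (_ , f)        = x , inj₁ refl , Px , inj₁ (fall-periodic f)
    ... | inj₂ (inj₁ (_ , ρ)) = x , inj₁ refl , Px , inj₂ (rise-periodic ρ)
    ... | inj₂ (inj₂ (z , Pz , (q , ρ) , (r , f))) =
      z , inj₂ ((_ , rise⇒walk ρ) , (_ , fall⇒walk f)) , Pz , direction
      where
      direction : Good z ⊎ Good (rev z)
      -- The sum once around from `z` to `z` compares consecutive lifts of `z`; its sign tells in
      -- which direction they get smaller.
      direction with sign (r + (cross x + q))
      ... | inj₂ pos = inj₂ (rise-periodic (fall-rise ℤₚ.≤-refl f Px ρ pos))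
      ... | inj₁ neg = inj₁ (fall-periodic (fall-append f Px
                         (climb ρ (subst (_≤ -1ℤ) (sym (ℤₚ.+-assoc r (cross x) q)) neg))))

  -- Enumeration of darts; joining, reversing and comparing walks

  edges : List E
  edges = elements finE

  vertices : List V
  vertices = elements finV

  darts : List Dart
  darts = map (_, true) edges ++ map (_, false) edges

  ∈-darts : ∀ x → x ∈ darts
  ∈-darts (e , true)  = ∈-++⁺ˡ (∈-map⁺ _ (∈-elements finE e))
  ∈-darts (e , false) = ∈-++⁺ʳ (map (_, true) edges) (∈-map⁺ _ (∈-elements finE e))

  darts-unique : Unique darts
  darts-unique = Unique.++⁺ (Unique.map⁺ ,-injectiveˡ (elements-unique finE))
    (Unique.map⁺ ,-injectiveˡ (elements-unique finE)) disjoint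
    where
    disjoint : ∀ {x} → ¬ (x ∈ map (_, true) edges × x ∈ map (_, false) edges)
    disjoint (p , q) with ∈-map⁻ _ p | ∈-map⁻ _ q
    ... | _ , _ , refl | _ , _ , ()

  ∑-darts : ∀ f → ∑ darts f ≡ ∑ edges (λ e → f (e , true) ℕ.+ f (e , false))
  ∑-darts f = trans (∑-++ (map (_, true) edges) _ f)
    (trans (cong₂ ℕ._+_ (∑-map (_, true) f edges) (∑-map (_, false) f edges)) (sym (∑-+ edges _ _)))

  Down? : ∀ n s → Decidable (Down n s)
  Down? zero    s x = yes tt
  Down? (suc n) s x = ∃? ∈-darts λ y → Cont? x y ×-dec (s + turn x y ℤₚ.≤? -1ℤ) ×-dec Down? n _ y

  module _ {P : Dart → Set} where

    walk-join : ∀ {x y z r s} → Walk P y x r → P y → Walk P z y s → ∃ (Walk P z x)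
    walk-join (last c _)      Py w′ = _ , step c Py w′ refl
    walk-join (step c Pz w _) Py w′ = _ , step c Pz (proj₂ (walk-join w Py w′)) refl

    module _ (P-rev : ∀ {x} → P x → P (rev x)) where

      -- Reversal with an accumulator: back along the first walk, then on along the second, which
      -- starts at `rev x`.
      reverse-onto : ∀ {x y z r s} → Walk P y x r → P x → Walk P z (rev x) s →
                     Walk P z (rev y) (s - (cross x + r))
      reverse-onto {x} {y} {s = s} (last c refl) Px w′ = step (Cont-rev c) (P-rev Px) w′ eq
        where
        id : ∀ s o t → s - (o + t) ≡ -1ℤ - t + (1ℤ - o + s)
        id = solve-∀
        eq : s - (cross x + turn x y) ≡ turn (rev y) (rev x) + (cross (rev x) + s)
        eq rewrite turn-rev c | cross-rev x = id s (cross x) (turn x y)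
      reverse-onto {x} {y} {z′} {s = s} (step {z} {q} c Pz w refl) Px w′ =
        subst (Walk P z′ (rev y)) eq (reverse-onto w Pz (step (Cont-rev c) (P-rev Px) w′ refl))
        where
        id : ∀ s o t q → -1ℤ - t + (1ℤ - o + s) - q ≡ s - (o + (t + q))
        id = solve-∀
        eq : turn (rev z) (rev x) + (cross (rev x) + s) - (cross z + q) ≡
             s - (cross x + (turn x z + (cross z + q)))
        eq rewrite turn-rev c | cross-rev x = id s (cross x) (turn x z) (cross z + q)

      walk-reverse : ∀ {x y r} → Walk P y x r → Walk P (rev x) (rev y) (-1ℤ - r)
      walk-reverse (last c refl) = last (Cont-rev c) (sym (turn-rev c))
      walk-reverse {x} {y} (step {z} {q} c Pz w refl) =
        subst (Walk P (rev x) (rev y)) eq (reverse-onto w Pz (last (Cont-rev c) refl))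
        where
        id : ∀ t q → -1ℤ - t - q ≡ -1ℤ - (t + q)
        id = solve-∀
        eq : turn (rev z) (rev x) - (cross z + q) ≡ -1ℤ - (turn x z + (cross z + q))
        eq rewrite turn-rev c = id (turn x z) (cross z + q)

      -- Two walks with a common start: dropping the common initial segment, the walk from
      -- one end to the other realises the comparison of the two ends.
      walk-compare : ∀ {x f g α β} → ¬ P f → ¬ P g → Walk P f x α → Walk P g x β → β - α ≤ -1ℤ →
                     ∃ λ r → Walk P g (rev f) r × r ≤ -1ℤ
      walk-compare {x} {f} {g} ¬Pf ¬Pg (last (s , f≢) refl) (last (s′ , g≢) refl) β<α with g ≟ᴰ f
      ... | yes refl = contradiction (subst (_≤ -1ℤ) (id (turn x f)) β<α) λ ()
        where
        id : ∀ t → t - t ≡ 0ℤ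
        id = solve-∀
      ... | no g≢f = _ , last (Cont-at (trans (sym s) s′) g≢f) refl ,
        ≤-by₂ β<α (turn-triangle x f g) (id (turn x f) (turn x g) (turn (rev f) g))
        where
        id : ∀ t u v → -1ℤ - v ≡ (-1ℤ - (u - t)) + (u - (t + v))
        id = solve-∀
      walk-compare {x} {f} {g} ¬Pf ¬Pg (last (s , f≢) refl) (step {z} {q} (s′ , z≢) Pz w refl) β<α =
        _ , step (Cont-at (trans (sym s) s′) λ { refl → ¬Pf Pz }) Pz w refl ,
        ≤-by₂ β<α (turn-triangle x f z) (id (turn x f) (turn x z) (turn (rev f) z) (cross z + q))
        where
        id : ∀ t u v q → -1ℤ - (v + q) ≡ (-1ℤ - (u + q - t)) + (u - (t + v))
        id = solve-∀
      walk-compare {x} {f} {g} ¬Pf ¬Pg (step {z} {q} (s , z≢) Pz w refl) (last (s′ , g≢) refl) β<α =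
        _ , reverse-onto w Pz (last (Cont-at (trans (sym s) s′) λ { refl → ¬Pg Pz }) refl) ,
        ≤-by₂ β<α (turn-triangle x z g) (id (turn x z) (turn x g) (turn (rev z) g) (cross z + q))
        where
        id : ∀ t u v q → -1ℤ - (v - q) ≡ (-1ℤ - (u - (t + q))) + (u - (t + v))
        id = solve-∀
      walk-compare {x} {f} {g} ¬Pf ¬Pg (step {z} {q} (s , _) Pz w refl) (step {z′} {q′} (s′ , _) Pz′ w′ refl) β<α
        with z′ ≟ᴰ z
      ... | yes refl = walk-compare ¬Pf ¬Pg w w′ (subst (_≤ -1ℤ) (id (turn x z) (cross z) q q′) β<α)
        where
        id : ∀ t o q q′ → t + (o + q′) - (t + (o + q)) ≡ q′ - q
        id = solve-∀
      ... | no z′≢z = _ , reverse-onto w Pz (step (Cont-at (trans (sym s) s′) z′≢z) Pz′ w′ refl) ,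
        ≤-by₂ β<α (turn-triangle x z z′)
          (id (turn x z) (turn x z′) (turn (rev z) z′) (cross z + q) (cross z′ + q′))
        where
        id : ∀ t u v q q′ → -1ℤ - (v + q′ - q) ≡ (-1ℤ - (u + q′ - (t + q))) + (u - (t + v))
        id = solve-∀

  -- Sums over the darts leaving a vertex

  outs : V → List Dart
  outs v = filter (λ x → src x ≟ⱽ v) darts

  outs-unique : ∀ v → Unique (outs v)
  outs-unique v = Unique.filter⁺ (λ x → src x ≟ⱽ v) darts-unique

  ∈-outs : ∀ {x v} → src x ≡ v → x ∈ outs v
  ∈-outs {x} s = ∈-filter⁺ _ (∈-darts x) s

  outs-src : ∀ {x v} → x ∈ outs v → src x ≡ v
  outs-src {v = v} x∈ = proj₂ (∈-filter⁻ (λ x → src x ≟ⱽ v) {xs = darts} x∈)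

  same-src : ∀ {x y v} → x ∈ outs v → y ∈ outs v → src x ≡ src y
  same-src x∈ y∈ = trans (outs-src x∈) (sym (outs-src y∈))

  ∑-outs : ∀ f → ∑ vertices (λ v → ∑ (outs v) f) ≡ ∑ darts f
  ∑-outs f = begin
    ∑ vertices (λ v → ∑ (outs v) f)                              ≡⟨ ∑-cong vertices (λ {v} _ → ∑-filter (λ x → src x ≟ⱽ v) darts f) ⟩
    ∑ vertices (λ v → ∑ darts (λ x → 𝟙 (src x ≟ⱽ v) ℕ.* f x))    ≡⟨ ∑-swap vertices darts _ ⟩
    ∑ darts (λ x → ∑ vertices (λ v → 𝟙 (src x ≟ⱽ v) ℕ.* f x))    ≡⟨ ∑-cong darts (λ {x} _ → one x) ⟩
    ∑ darts f                                                    ∎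
    where
    open ≡-Reasoning
    one : ∀ x → ∑ vertices (λ v → 𝟙 (src x ≟ⱽ v) ℕ.* f x) ≡ f x
    one x = trans (∑-single (elements-unique finV) (∈-elements finV (src x))
        (λ {v} v≢ → cong (ℕ._* f x) (𝟙-false (src x ≟ⱽ v) (v≢ ∘ sym))))
      (trans (cong (ℕ._* f x) (𝟙-true (src x ≟ⱽ src x) refl)) (ℕ.+-identityʳ (f x)))

  ∑-rev : ∀ f → ∑ darts (f ∘ rev) ≡ ∑ darts f
  ∑-rev f = trans (∑-darts (f ∘ rev)) (trans
    (∑-cong edges λ {e} _ → ℕ.+-comm (f (e , false)) (f (e , true))) (sym (∑-darts f)))

  -- Trees and cycles in a subgraph given by a symmetric set of darts

  module Subgraph (P : Dart → Set) (P? : Decidable P) (P-rev : ∀ {x} → P x → P (rev x)) (n : ℕ) (n-large : length darts ℕ.≤ n) where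

    Long : ℕ → Dart → Set
    Long zero    x = P x
    Long (suc k) x = P x × ∃ λ y → Cont x y × Long k y

    Long? : ∀ k → Decidable (Long k)
    Long? zero    x = P? x
    Long? (suc k) x = P? x ×-dec ∃? ∈-darts λ y → Cont? x y ×-dec Long? k y

    long⇒P : ∀ k {x} → Long k x → P x
    long⇒P zero    Px       = Px
    long⇒P (suc k) (Px , _) = Px

    long-pred : ∀ k {x} → Long (suc k) x → Long k x
    long-pred zero    (Px , _)         = Px
    long-pred (suc k) (Px , y , c , l) = Px , y , c , long-pred k l

    long-≤ : ∀ {j k x} → j ℕ.≤ k → Long k x → Long j x
    long-≤ {j} j≤k l with ℕ.≤⇒≤′ j≤k
    ... | j≤′k = go j≤′k l
      where
      go : ∀ {k x} → j ℕ.≤′ k → Long k x → Long j x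
      go ℕ.≤′-refl       l = l
      go {suc k} (ℕ.≤′-step j≤k) l = go j≤k (long-pred k l)

    -- As n bounds the number of darts, these darts start arbitrarily long walks in P.
    R : Dart → Set
    R = Long n

    R? : Decidable R
    R? = Long? n

    R-stable : ∀ {x} → R x → Long (suc n) x
    R-stable = chain-stable ∈-darts Long? (λ k → long-pred k)
      (λ k stable (Px , y , c , l) → Px , y , c , stable l) n-large

    R-pred : ∀ {x y} → P x → Cont x y → R y → R x
    R-pred Px c Ry = long-pred n (Px , _ , c , Ry)

    -- Expresses through walks leaving `v` that the component of `v` in `P` is not a tree.
    U : V → Set
    U v = ∃ λ x → src x ≡ v × R x

    U? : Decidable U
    U? v = ∃? ∈-darts λ x → (src x ≟ⱽ v) ×-dec R? x

    -- If the long walk from the target starts back along `x`, its second dart leaves `src x` and is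
    -- again in `R` by stability.
    U-pred : ∀ {x} → P x → U (tgt x) → U (src x)
    U-pred {x} Px (y , s , Ry) with y ≟ᴰ rev x
    ... | no y≢ = x , refl , R-pred Px (sym s , y≢) Ry
    ... | yes refl with R-stable Ry
    ...   | _ , z , (s′ , _) , Rz = z , trans (sym s′) (cong src (rev-involutive x)) , Rz

    walk-U : ∀ {x y r} → Walk P y x r → U (src y) → U (tgt x)
    walk-U (last (s , _) _)                   u = subst U (sym s) u
    walk-U (step {z} (s , _) Pz w _) u = subst U (sym s) (U-pred Pz (walk-U w u))

    -- Walks without their sums but with the number of inner darts, so that `chain-return` can
    -- recurse by removing darts at both ends.
    Chain : ℕ → Dart → Dart → Set
    Chain zero    x y = Cont x y
    Chain (suc k) x y = ∃ λ z → Cont x z × P z × Chain k z y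

    walk⇒chain : ∀ {x y r} → Walk P y x r → ∃ λ k → Chain k x y
    walk⇒chain (last c _)      = zero , c
    walk⇒chain (step c Pz w _) = let k , ch = walk⇒chain w in suc k , _ , c , Pz , ch

    unsnoc : ∀ k {x y} → Chain (suc k) x y → ∃ λ z → P z × Chain k x z × Cont z y
    unsnoc zero    (z , c , Pz , c′) = z , Pz , c , c′
    unsnoc (suc k) (z , c , Pz , ch) = let q , Pq , ch′ , c′ = unsnoc k ch in q , Pq , (z , c , Pz , ch′) , c′

    snoc : ∀ k {x y z} → Chain k x y → P y → Cont y z → Chain (suc k) x z
    snoc zero    c                  Py c′ = _ , c , Py , c′
    snoc (suc k) (z , c , Pz , ch) Py c′ = z , c , Pz , snoc k ch Py c′

    long-chain : ∀ k m {x y} → P x → Chain k x y → Long m y → Long (suc m) x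
    long-chain zero    m Px c               l = Px , _ , c , l
    long-chain (suc k) m Px (z , c , Pz , ch) l = Px , z , c , long-pred m (long-chain k m Pz ch l)

    long-periodic : ∀ k {x} → P x → Chain k x x → ∀ m → Long m x
    long-periodic k Px ch zero    = Px
    long-periodic k Px ch (suc m) = long-chain k m Px ch (long-periodic k Px ch m)

    -- A walk that returns along its first dart runs around a cycle of P.
    chain-return : ∀ k {x} → Chain k x (rev x) → U (tgt x)
    chain-return zero (_ , rev≢rev) = contradiction refl rev≢rev
    chain-return (suc zero) {x} (z , (s , _) , Pz , (s′ , _)) =
      z , sym s , long-periodic zero Pz (trans s′ s , rev≢ z ∘ sym) n
    chain-return (suc (suc k)) {x} (z , (s , _) , Pz , ch) with unsnoc k ch
    ... | q , Pq , ch′ , (s′ , _) with q ≟ᴰ rev z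
    ...   | yes refl = subst U (sym s) (U-pred Pz (chain-return k ch′))
    ...   | no q≢    = z , sym s , long-periodic (suc k) Pz (snoc k ch′ Pq (trans s′ s ,
              λ eq → q≢ (trans (sym (rev-involutive q)) (cong rev (sym eq))))) n

    -- The descent is cut at its first dart outside `P`. Without one, the `suc m` darts after `x`
    -- all lie in `P`, which is `Long m` at the first of them.
    descend : ∀ m s {x} → Down (suc m) s x →
              (∃₂ λ y r → ¬ P y × Fall P y x s r) ⊎ (∃ λ y → Cont x y × Long m y)
    descend m s (y , c , neg , d) with P? y
    ... | no ¬Py = inj₁ (y , _ , ¬Py , last c refl neg)
    descend zero    s (y , c , neg , d) | yes Py = inj₂ (y , c , Py)
    descend (suc m) s (y , c , neg , d) | yes Py with descend m _ d
    ... | inj₁ (z , r , ¬Pz , w) = inj₁ (z , r , ¬Pz , step c Py neg w)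
    ... | inj₂ (z , c′ , l)      = inj₂ (y , c , Py , z , c′ , l)

    -- If the component of P entered by x were a tree then, as darts outside P run downhill,
    -- the walks through it would give an infinite descent among the darts entering it.
    outside⇒U : (∀ {x} → ¬ P x → Down (suc n) 0ℤ x) → ∀ {x} → ¬ P x → U (tgt x)
    outside⇒U down {x} ¬Px = decidable-stable (U? (tgt x)) λ ¬Ux →
      let b , (_ , ¬Ub) , (_ , w , _) = serial-transitive⇒loop finDart serial transitive (x , ¬Px , ¬Ux)
          k , ch = walk⇒chain w
      in ¬Ub (chain-return k ch)
      where
      finDart : Finite Dart
      finDart = finite-× finE (2 , ↔-sym 2↔Bool)
      B : Dart → Set
      B b = ¬ P b × ¬ U (tgt b)
      -- Both `b` and `c` enter the piece; the walk leaves it against `c`, and its negative sum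
      -- makes the edge of `c` the smaller one.
      _≻_ : Dart → Dart → Set
      b ≻ c = ∃ λ r → Walk P (rev c) b r × r ≤ -1ℤ
      serial : ∀ {b} → B b → ∃ λ c → B c × b ≻ c
      serial {b} (¬Pb , ¬Ub) with descend n 0ℤ (down ¬Pb)
      ... | inj₂ (y , (s , _) , l) = contradiction (y , sym s , l) ¬Ub
      ... | inj₁ (y , r , ¬Py , w) = rev y ,
        (¬Py ∘ subst P (rev-involutive y) ∘ P-rev ,
         ¬Ub ∘ walk-U (fall⇒walk w) ∘ subst (U ∘ src) (rev-involutive y)) ,
        r - 0ℤ , subst (λ d → Walk P d b (r - 0ℤ)) (sym (rev-involutive y)) (fall⇒walk w) ,
        subst (_≤ -1ℤ) (sym (ℤₚ.+-identityʳ r)) (fall-≤ w)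
      transitive : ∀ {b c d} → B b → B c → B d → b ≻ c → c ≻ d → b ≻ d
      -- Once the first walk is reversed, both start at `c`, and the difference of their sums is
      -- `r + r′ + 1`, at most `-1`.
      transitive {b} {c} {d} (¬Pb , _) _ (¬Pd , _) (r , w , r≤) (r′ , w′ , r′≤) =
        subst (λ e → ∃ λ r → Walk P (rev d) e r × r ≤ -1ℤ) (rev-involutive b)
          (walk-compare P-rev (¬Pb ∘ subst P (rev-involutive b) ∘ P-rev) (¬Pd ∘ subst P (rev-involutive d) ∘ P-rev)
            (subst (λ e → Walk P (rev b) e _) (rev-involutive c) (walk-reverse P-rev w)) w′
            (≤-by₂ r≤ r′≤ (eq r r′)))
        where
        eq : ∀ r r′ → -1ℤ - (r′ - (-1ℤ - r)) ≡ (-1ℤ - r) + (-1ℤ - r′)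
        eq = solve-∀

    -- The darts of an edge share a weight of at most 2, all of which goes to the direction
    -- leading into a cycle if only one does.
    R-weight : Dart → ℕ
    R-weight x = 𝟙 (R? x) ℕ.+ 𝟙 (R? x ×-dec ¬? (R? (rev x)))

    R-weight-pair : ∀ x → R-weight x ℕ.+ R-weight (rev x) ℕ.≤ 2
    R-weight-pair x rewrite rev-involutive x with R? x | R? (rev x)
    ... | yes _ | yes _ = ℕ.≤-refl
    ... | yes _ | no _  = ℕ.≤-refl
    ... | no _  | yes _ = ℕ.≤-refl
    ... | no _  | no _  = ℕ.z≤n

    R-weight-outside : ∀ {x} → ¬ P x → R-weight x ≡ 0
    R-weight-outside {x} ¬Px with R? x
    ... | yes Rx = contradiction (long⇒P n Rx) ¬Px
    ... | no _   = refl

    -- If the reverse of a dart of `R` at `v` is in `R` too, it continues along a second dart of `R`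
    -- at `v`; otherwise the first dart alone has weight 2.
    2≤R-weights : ∀ {v} → U v → 2 ℕ.≤ ∑ (outs v) R-weight
    2≤R-weights {v} (x , s , Rx) with R? (rev x)
    ... | no ¬Rx̄ = ℕ.≤-trans (ℕ.≤-reflexive (sym (cong₂ ℕ._+_ (𝟙-true (R? x) Rx)
                     (𝟙-true (R? x ×-dec ¬? (R? (rev x))) (Rx , ¬Rx̄))))) (term≤∑ R-weight (∈-outs s))
    ... | yes Rx̄ with R-stable Rx̄
    ...   | _ , y , (s′ , y≢) , Ry = ℕ.≤-trans (ℕ.+-mono-≤ (positive Rx) (positive Ry))
              (two-terms≤∑ R-weight (λ { refl → y≢ (sym (rev-involutive x)) }) (∈-outs s)
                (∈-outs (trans (sym s′) (trans (cong src (rev-involutive x)) s))))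
      where
      positive : ∀ {z} → R z → 1 ℕ.≤ R-weight z
      positive {z} Rz = ℕ.≤-trans (ℕ.≤-reflexive (sym (𝟙-true (R? z) Rz))) (ℕ.m≤m+n _ _)

    -- The core of the subgraph: the edges on cycles or on paths between cycles.
    W : Dart → Set
    W x = R x × R (rev x)

    W? : Decidable W
    W? x = R? x ×-dec R? (rev x)

    W⇒P : ∀ {x} → W x → P x
    W⇒P = long⇒P n ∘ proj₁

    W-rev : ∀ {x} → W x → W (rev x)
    W-rev {x} (Rx , Rx̄) = Rx̄ , subst R (sym (rev-involutive x)) Rx

    W-cont : ∀ {x} → W x → ∃ λ y → Cont x y × W y
    W-cont {x} (Rx , Rx̄) with R-stable Rx
    ... | Px , y , c , Ry = y , c , Ry , R-pred (P-rev (long⇒P n Ry)) (Cont-rev c) Rx̄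

    -- The length of the longest walk in P from x, capped at k.
    level : ℕ → Dart → ℕ
    level zero    x = zero
    level (suc k) x with Long? (suc k) x
    ... | yes _ = suc k
    ... | no _  = level k x

    level-≤ : ∀ k x → level k x ℕ.≤ k
    level-≤ zero    x = ℕ.z≤n
    level-≤ (suc k) x with Long? (suc k) x
    ... | yes _ = ℕ.≤-refl
    ... | no _  = ℕ.m≤n⇒m≤1+n (level-≤ k x)

    long-level : ∀ k {x} → P x → Long (level k x) x
    long-level zero    Px = Px
    long-level (suc k) {x} Px with Long? (suc k) x
    ... | yes l = l
    ... | no _  = long-level k Px

    ≤-level : ∀ k {j x} → j ℕ.≤ k → Long j x → j ℕ.≤ level k x
    ≤-level zero    j≤0 _ = j≤0
    ≤-level (suc k) {j} {x} j≤k l with Long? (suc k) x | j ℕ.≟ suc k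
    ... | yes _ | _        = j≤k
    ... | no ¬l | yes refl = contradiction l ¬l
    ... | no _  | no j≢    = ≤-level k (ℕ.≤-pred (ℕ.≤∧≢⇒< j≤k j≢)) l

    height : Dart → ℕ
    height = level n

    -- The darts of an edge of P share a weight of 2, all of which goes to the direction allowing
    -- the longer walks, if there is one.
    level-weight : Dart → ℕ
    level-weight x = 𝟙 (P? x) ℕ.* (𝟙 (height (rev x) ℕ.≤? height x) ℕ.+ 𝟙 (height (rev x) ℕ.<? height x))

    level-weight-pair : ∀ {x} → P x → 2 ℕ.≤ level-weight x ℕ.+ level-weight (rev x)
    level-weight-pair {x} Px rewrite rev-involutive x | 𝟙-true (P? x) Px | 𝟙-true (P? (rev x)) (P-rev Px)
      with height (rev x) ℕ.≤? height x | height (rev x) ℕ.<? height x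
         | height x ℕ.≤? height (rev x) | height x ℕ.<? height (rev x)
    ... | yes _ | yes _ | _     | _     = ℕ.s≤s (ℕ.s≤s ℕ.z≤n)
    ... | yes _ | no _  | yes _ | _     = ℕ.s≤s (ℕ.s≤s ℕ.z≤n)
    ... | no _  | _     | yes _ | yes _ = ℕ.m≤n+m 2 _
    ... | yes _ | no ≮  | no ≰  | _     = contradiction (ℕ.≮⇒≥ ≮) ≰
    ... | no ≰  | _     | no ≰′ | _     = contradiction (ℕ.≰⇒≥ ≰) ≰′
    ... | no ≰  | _     | yes _ | no ≮  = contradiction (ℕ.≰⇒> ≰) ≮

    level-weight-≤2 : ∀ x → level-weight x ℕ.≤ 2
    level-weight-≤2 x = ℕ.*-mono-≤ (𝟙-≤1 (P? x)) (ℕ.+-mono-≤ (𝟙-≤1 (height (rev x) ℕ.≤? height x)) (𝟙-≤1 (height (rev x) ℕ.<? height x)))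

    level-weight-positive : ∀ {x} → 0 ℕ.< level-weight x → P x × height (rev x) ℕ.≤ height x
    level-weight-positive {x} 0<w with P? x | height (rev x) ℕ.≤? height x | height (rev x) ℕ.<? height x
    ... | yes Px | yes ≤ | _     = Px , ≤
    ... | yes Px | no _  | yes < = Px , ℕ.<⇒≤ <
    level-weight-positive () | yes _ | no _ | no _
    level-weight-positive () | no _  | _    | _

    W-level-weight : ∀ {x} → W x → level-weight x ℕ.≤ 1
    W-level-weight {x} (_ , Rx̄) = ℕ.≤-trans (ℕ.*-monoˡ-≤ _ (𝟙-≤1 (P? x))) (ℕ.≤-trans (ℕ.≤-reflexive (ℕ.+-identityʳ _))
      (ℕ.+-mono-≤ (𝟙-≤1 (height (rev x) ℕ.≤? height x)) (ℕ.≤-reflexive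
        (𝟙-false (height (rev x) ℕ.<? height x) top))))
      where
      top : ¬ (height (rev x) ℕ.< height x)
      top < = ℕ.<⇒≱ < (ℕ.≤-trans (level-≤ n x) (≤-level n ℕ.≤-refl Rx̄))

    -- Going along `rev x` and on from `y` gives a walk longer than `height x`, although `rev x` is
    -- no higher than `x`. Hence `height x` has reached the cap `n`, and each dart prolongs the
    -- reverse of the other.
    ordered-pair⇒W : ∀ {x y} → src x ≡ src y → x ≢ y → 0 ℕ.< level-weight x → 0 ℕ.< level-weight y →
             height x ℕ.≤ height y → W x × W y
    ordered-pair⇒W {x} {y} s x≢y 0<x 0<y x≤y with level-weight-positive 0<x | level-weight-positive 0<y
    ... | Px , x̄≤x | Py , _ = (Rx , R-pred (P-rev Px) (Cont-at s (x≢y ∘ sym)) Ry) , (Ry , R-pred (P-rev Py) (Cont-at (sym s) x≢y) Rx)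
      where
      x̄-long : Long (suc (height x)) (rev x)
      x̄-long = P-rev Px , y , Cont-at s (x≢y ∘ sym) , long-≤ x≤y (long-level n Py)
      n≤x : n ℕ.≤ height x
      n≤x = ℕ.≮⇒≥ λ x<n → ℕ.<⇒≱ (≤-level n x<n x̄-long) x̄≤x
      Rx : R x
      Rx = long-≤ n≤x (long-level n Px)
      Ry : R y
      Ry = long-≤ (ℕ.≤-trans n≤x x≤y) (long-level n Py)

    pair⇒W : ∀ {x y} → src x ≡ src y → x ≢ y → 0 ℕ.< level-weight x → 0 ℕ.< level-weight y → W x × W y
    pair⇒W s x≢y 0<x 0<y with ℕ.≤-total (height _) (height _)
    ... | inj₁ x≤y = ordered-pair⇒W s x≢y 0<x 0<y x≤y
    ... | inj₂ y≤x = let Wy , Wx = ordered-pair⇒W (sym s) (x≢y ∘ sym) 0<y 0<x y≤x in Wx , Wy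

    -- Two darts of positive weight at a vertex lie in `W` and weigh 1 each; a third would be a
    -- branching of `W`.
    level-weights≤2 : (∀ {x y z} → src x ≡ src y → src x ≡ src z → x ≢ y → x ≢ z → y ≢ z → W x → W y → W z → ⊥) →
                      ∀ v → ∑ (outs v) level-weight ℕ.≤ 2
    level-weights≤2 no-branching v = ∑-≤-two-terms (outs-unique v) (λ {x} _ → level-weight-≤2 x)
      (λ x∈ y∈ x≢y 0<x 0<y → W-level-weight (proj₁ (pair⇒W (same-src x∈ y∈) x≢y 0<x 0<y)))
      (λ x∈ y∈ z∈ x≢y x≢z y≢z 0<x 0<y 0<z →
        let Wx , Wy = pair⇒W (same-src x∈ y∈) x≢y 0<x 0<y
            _  , Wz = pair⇒W (same-src x∈ z∈) x≢z 0<x 0<z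
        in no-branching (same-src x∈ y∈) (same-src x∈ z∈) x≢y x≢z y≢z Wx Wy Wz)

    -- Reachability and branching in the core

    Avoids : Dart → ℕ → Dart → Set
    Avoids z zero    x = ⊤
    Avoids z (suc k) x = x ≢ z × ∀ y → Cont x y → W y → Avoids z k y

    Avoids? : ∀ z k → Decidable (Avoids z k)
    Avoids? z zero    x = yes tt
    Avoids? z (suc k) x = ¬? (x ≟ᴰ z) ×-dec ∀? ∈-darts λ y → Cont? x y →-dec (W? y →-dec Avoids? z k y)

    avoids-pred : ∀ z k {x} → Avoids z (suc k) x → Avoids z k x
    avoids-pred z zero    _         = tt
    avoids-pred z (suc k) (x≢z , f) = x≢z , λ y c Wy → avoids-pred z k (f y c Wy)

    Reach : Dart → Dart → Set
    Reach x y = ∃ (Walk W y x)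

    reach-rev : ∀ {x y} → Reach x y → Reach (rev y) (rev x)
    reach-rev (_ , w) = _ , walk-reverse W-rev w

    reach-trans : ∀ {x y z} → Reach x y → W y → Reach y z → Reach x z
    reach-trans (_ , w) Wy (_ , w′) = walk-join w Wy w′

    ¬avoids⇒reach : ∀ {z} k {x} → ¬ Avoids z k x → x ≡ z ⊎ Reach x z
    ¬avoids⇒reach zero ¬a = contradiction tt ¬a
    ¬avoids⇒reach {z} (suc k) {x} ¬a with x ≟ᴰ z
    ... | yes x≡z = inj₁ x≡z
    ... | no x≢z with ¬∀⇒∃¬ ∈-darts (λ y → Cont? x y →-dec (W? y →-dec Avoids? z k y)) (¬a ∘ (x≢z ,_))
    ...   | y , ¬f with Cont? x y | W? y
    ...     | no ¬c | _      = contradiction (λ c → contradiction c ¬c) ¬f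
    ...     | yes _ | no ¬Wy = contradiction (λ _ Wy → contradiction Wy ¬Wy) ¬f
    ...     | yes c | yes Wy with ¬avoids⇒reach k (λ a → ¬f λ _ _ → a)
    ...       | inj₁ refl    = inj₂ (_ , last c refl)
    ...       | inj₂ (_ , w) = inj₂ (_ , step c Wy w refl)

    module Branching {a b c : Dart} (a~b : src a ≡ src b) (a~c : src a ≡ src c) (a≢b : a ≢ b) (a≢c : a ≢ c) (b≢c : b ≢ c) (Wa : W a) (Wb : W b) (Wc : W c) where

      -- Were rev a not reachable from a, the darts of W that do not reach rev a would be
      -- closed under continuation; at every vertex at least as many of them leave as arrive,
      -- and strictly more at the source of a.
      turn-around : Reach a (rev a)
      turn-around with Avoids? (rev a) n a
      ... | no ¬avoids with ¬avoids⇒reach n ¬avoids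
      ...   | inj₁ a≡ā = contradiction (sym a≡ā) (rev≢ a)
      ...   | inj₂ w   = w
      turn-around | yes avoids = contradiction unbalanced (ℕ.<-irrefl balanced)
        where
        C : Dart → Set
        C x = W x × Avoids (rev a) n x
        C? : Decidable C
        C? x = W? x ×-dec Avoids? (rev a) n x
        -- Avoidance up to the bound `n` holds for every length, so it survives one more
        -- continuation.
        C-stable : ∀ {x} → C x → Avoids (rev a) (suc n) x
        C-stable (_ , av) = chain-stable ∈-darts (Avoids? (rev a)) (avoids-pred (rev a))
          (λ k st (x≢ , f) → x≢ , λ y c Wy → st (f y c Wy)) n-large av
        spread : ∀ {v x y} → x ∈ outs v → y ∈ outs v → C (rev x) → W y → y ≢ x → C y
        spread x∈ y∈ Cx̄ Wy y≢x = Wy , proj₂ (C-stable Cx̄) _ (Cont-at (same-src x∈ y∈) y≢x) Wy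
        in⊆W : ∀ {x} → C (rev x) → W x
        in⊆W {x} (Wx̄ , _) = subst W (rev-involutive x) (W-rev Wx̄)
        continue : ∀ {v x} → x ∈ outs v → C (rev x) → ∃ λ y → y ∈ outs v × W y × y ≢ x
        continue {v} {x} x∈ (Wx̄ , _) with W-cont Wx̄
        ... | y , (s , y≢) , Wy = y , ∈-outs (trans (sym s) (trans (cong src (rev-involutive x)) (outs-src x∈))) , Wy ,
          λ { refl → y≢ (sym (rev-involutive x)) }
        -- Reversal permutes the darts, so over all vertices as many darts of `C` arrive as leave.
        balanced : ∑ vertices (λ v → ∑ (outs v) (𝟙 ∘ C? ∘ rev)) ≡ ∑ vertices (λ v → ∑ (outs v) (𝟙 ∘ C?))
        balanced = trans (∑-outs (𝟙 ∘ C? ∘ rev)) (trans (∑-rev (𝟙 ∘ C?)) (sym (∑-outs (𝟙 ∘ C?))))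
        unbalanced : ∑ vertices (λ v → ∑ (outs v) (𝟙 ∘ C? ∘ rev)) ℕ.< ∑ vertices (λ v → ∑ (outs v) (𝟙 ∘ C?))
        unbalanced = ∑-mono-<
          (λ {v} _ → ∑I≤∑O _≟ᴰ_ (outs-unique v) (C? ∘ rev) C? in⊆W spread continue)
          (∈-elements finV (src a))
          (∑I<∑O _≟ᴰ_ (outs-unique (src a)) (C? ∘ rev) C? in⊆W spread
            (∈-outs refl) (∈-outs (sym a~b)) (∈-outs (sym a~c)) a≢b a≢c b≢c Wb Wc
            -- The dart `rev a` is not in `C`, as it does not avoid itself.
            (λ Cā → proj₁ (C-stable Cā) refl) (Wa , avoids))

    -- Turning around beyond `a` and beyond `b` closes up to a cycle through `a`. Its largest dart
    -- runs downhill in one direction, and a line with that descent at both ends has a peak.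
    no-branching : (∀ {x} → P x → Good x → Good (rev x) → ⊥) →
      ∀ {a b c} → src a ≡ src b → src a ≡ src c → a ≢ b → a ≢ c → b ≢ c → W a → W b → W c → ⊥
    no-branching no-peak {a} {b} {c} a~b a~c a≢b a≢c b≢c Wa Wb Wc = from-cycle (cycle-maximum Wa (proj₂ cycle))
      where
      a→ā : Reach a (rev a)
      a→ā = Branching.turn-around a~b a~c a≢b a≢c b≢c Wa Wb Wc
      b→b̄ : Reach b (rev b)
      b→b̄ = Branching.turn-around (sym a~b) (trans (sym a~b) a~c) (a≢b ∘ sym) b≢c a≢c Wb Wa Wc
      ā→b : Reach (rev a) b
      ā→b = _ , last (Cont-at a~b (a≢b ∘ sym)) refl
      b→a : Reach b a
      b→a = reach-trans b→b̄ (W-rev Wb) (_ , last (Cont-at (sym a~b) a≢b) refl)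
      cycle : Reach a a
      cycle = reach-trans a→ā (W-rev Wa) (reach-trans ā→b Wb b→a)
      line : ∀ {g} → W g → Good g → Reach a g → ⊥
      line {g} Wg good a→g =
        -- Back from `rev g` to the branching, across to `b`, around to `a` and out to `g`: beyond
        -- either end, the line continues with the descent from `g`.
        let ḡ→g = reach-trans (reach-rev a→g) (W-rev Wa) (reach-trans ā→b Wb (reach-trans b→a Wa a→g))
            z , Wz , good-z , good-z̄ = peak (W-rev Wg) Wg (proj₂ ḡ→g) (subst Good (sym (rev-involutive g)) good) good
        in no-peak (W⇒P Wz) good-z good-z̄
      from-cycle : (∃ λ z → (z ≡ a ⊎ Reach a z × Reach z a) × W z × (Good z ⊎ Good (rev z))) → ⊥
      from-cycle (z , on-cycle , Wz , direction) = go direction on-cycle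
        where
        go : Good z ⊎ Good (rev z) → (z ≡ a ⊎ Reach a z × Reach z a) → ⊥
        go (inj₁ good) (inj₁ refl)      = line Wz good cycle
        go (inj₁ good) (inj₂ (a→z , _)) = line Wz good a→z
        go (inj₂ good) (inj₁ refl)      = line (W-rev Wz) good a→ā
        go (inj₂ good) (inj₂ (_ , z→a)) = line (W-rev Wz) good (reach-trans a→ā (W-rev Wa) (reach-rev z→a))

  -- Sums over connected components

  Connected-sym : ∀ {u v} → Connected u v → Connected v u
  Connected-sym = Eq.symmetric Adjacent

  Connected-trans : ∀ {u v w} → Connected u v → Connected v w → Connected u w
  Connected-trans = Eq.transitive Adjacent

  ∈-componentE : ∀ {x e} → e ∈ componentE x → Connected x (tail e)
  ∈-componentE {x} e∈ = proj₂ (∈-filter⁻ (λ e → connected? x (tail e)) {xs = edges} e∈)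

  ∈-componentV : ∀ {x v} → v ∈ componentV x → Connected x v
  ∈-componentV {x} v∈ = proj₂ (∈-filter⁻ (connected? x) {xs = vertices} v∈)

  -- The double count behind both bounds: weights of darts are estimated at each vertex on one side
  -- and on each edge on the other.
  ∑-component : ∀ x f → ∑ (componentV x) (λ v → ∑ (outs v) f) ≡ ∑ (componentE x) (λ e → f (e , true) ℕ.+ f (e , false))
  ∑-component x f = begin
    ∑ (componentV x) (λ v → ∑ (outs v) f)                        ≡⟨ ∑-filter (connected? x) vertices _ ⟩
    ∑ vertices (λ v → 𝟙 (connected? x v) ℕ.* ∑ (outs v) f)       ≡⟨ ∑-cong vertices (λ {v} _ → inside v) ⟩
    ∑ vertices (λ v → ∑ (outs v) f′)                             ≡⟨ ∑-outs f′ ⟩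
    ∑ darts f′                                                   ≡⟨ ∑-darts f′ ⟩
    ∑ edges (λ e → f′ (e , true) ℕ.+ f′ (e , false))             ≡⟨ ∑-cong edges (λ {e} _ → at-tail e) ⟩
    ∑ edges (λ e → 𝟙 (connected? x (tail e)) ℕ.* (f (e , true) ℕ.+ f (e , false)))
                                                                 ≡⟨ sym (∑-filter (λ e → connected? x (tail e)) edges _) ⟩
    ∑ (componentE x) (λ e → f (e , true) ℕ.+ f (e , false))      ∎
    where
    open ≡-Reasoning
    f′ : Dart → ℕ
    f′ d = 𝟙 (connected? x (src d)) ℕ.* f d
    inside : ∀ v → 𝟙 (connected? x v) ℕ.* ∑ (outs v) f ≡ ∑ (outs v) f′
    inside v = trans (sym (∑-*ˡ (outs v) (𝟙 (connected? x v)) f))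
      (∑-cong (outs v) λ {d} d∈ → cong (λ u → 𝟙 (connected? x u) ℕ.* f d) (sym (outs-src d∈)))
    at-tail : ∀ e → f′ (e , true) ℕ.+ f′ (e , false) ≡ 𝟙 (connected? x (tail e)) ℕ.* (f (e , true) ℕ.+ f (e , false))
    at-tail e = trans (cong (λ i → f′ (e , true) ℕ.+ i ℕ.* f (e , false))
        (𝟙-cong (connected? x (head e)) (connected? x (tail e))
          (λ x~h → Connected-trans x~h (bwd (e , refl , refl) ◅ ε))
          (λ x~t → Connected-trans x~t (fwd (e , refl , refl) ◅ ε))))
      (sym (ℕ.*-distribˡ-+ (𝟙 (connected? x (tail e))) _ _))

  components-cover : ∀ v → ∑ components (λ x → 𝟙 (connected? x v)) ≡ 1
  components-cover v = ℕ.≤-antisym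
    (∑-≤-one-term (AllPairs.map (λ x≁y → λ { refl → x≁y ε }) apart) (λ {x} _ → 𝟙-≤1 (connected? x v)) lone)
    (let x , x∈ , x~v = find representative
     in ℕ.≤-trans (ℕ.≤-reflexive (sym (𝟙-true (connected? x v) x~v))) (term≤∑ (λ x → 𝟙 (connected? x v)) x∈))
    where
    connected-decSetoid : DecSetoid _ _
    connected-decSetoid = record
      { Carrier = V ; _≈_ = Connected
      ; isDecEquivalence = record { isEquivalence = Eq.isEquivalence Adjacent ; _≟_ = connected? } }
    apart : AllPairs (λ x y → ¬ Connected x y) components
    apart = deduplicate-! connected-decSetoid vertices
    representative : Any.Any (λ x → Connected x v) components
    representative = Any.deduplicate⁺ connected? (λ y~x x~v → Connected-trans y~x x~v)
      (lose (∈-elements finV v) ε)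
    lone : ∀ {x y} → x ∈ components → y ∈ components → x ≢ y → 0 ℕ.< 𝟙 (connected? x v) → 0 ℕ.< 𝟙 (connected? y v) → ⊥
    lone {x} {y} x∈ y∈ x≢y _ _ with connected? x v | connected? y v
    ... | yes x~v | yes y~v = allPairs-lookup (_∘ Connected-sym) apart x∈ y∈ x≢y (Connected-trans x~v (Connected-sym y~v))
    lone _ _ _ () _ | no _ | _
    lone _ _ _ _ () | yes _ | no _

  ∑-components : ∀ f → ∑ components (λ x → ∑ (componentE x) f) ≡ ∑ edges f
  ∑-components f = begin
    ∑ components (λ x → ∑ (componentE x) f)                                   ≡⟨ ∑-cong components (λ {x} _ → ∑-filter (λ e → connected? x (tail e)) edges f) ⟩
    ∑ components (λ x → ∑ edges (λ e → 𝟙 (connected? x (tail e)) ℕ.* f e))    ≡⟨ ∑-swap components edges _ ⟩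
    ∑ edges (λ e → ∑ components (λ x → 𝟙 (connected? x (tail e)) ℕ.* f e))    ≡⟨ ∑-cong edges (λ {e} _ → once e) ⟩
    ∑ edges f                                                                 ∎
    where
    open ≡-Reasoning
    once : ∀ e → ∑ components (λ x → 𝟙 (connected? x (tail e)) ℕ.* f e) ≡ f e
    once e = trans (∑-cong components (λ {x} _ → ℕ.*-comm (𝟙 (connected? x (tail e))) (f e)))
      (trans (∑-*ˡ components (f e) _) (trans (cong (f e ℕ.*_) (components-cover (tail e))) (ℕ.*-identityʳ (f e))))

  -- Finite-level version of Mineyev's order-essential edges.
  Essential : ℕ → E → Set
  Essential n e = Down n 0ℤ (e , true) × Down n 0ℤ (e , false)

  Essential? : ∀ n → Decidable (Essential n)
  Essential? n e = Down? n 0ℤ (e , true) ×-dec Down? n 0ℤ (e , false)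

  essential⇒down : ∀ {n} x → Essential n (proj₁ x) → Down n 0ℤ x
  essential⇒down (_ , true)  = proj₁
  essential⇒down (_ , false) = proj₂

  good⇒essential : ∀ n x → Good x → Good (rev x) → Essential n (proj₁ x)
  good⇒essential n (_ , true)  good good′ = good n , good′ n
  good⇒essential n (_ , false) good good′ = good′ n , good n

  -- Essential edges against the reduced cyclicity

  Ordinary : ℕ → Dart → Set
  Ordinary n x = ¬ Essential n (proj₁ x)

  essentials : ℕ → ℕ
  essentials n = ∑ edges (𝟙 ∘ Essential? n)

  essentials-in : ℕ → V → ℕ
  essentials-in n x = ∑ (componentE x) (𝟙 ∘ Essential? n)

  -- Every ordinary edge carries weight at least 2 and every vertex receives at most 2, so ordinary
  -- edges are no more numerous than vertices.
  edges≤vertices+essentials : ∀ n x → length (componentE x) ℕ.≤ length (componentV x) ℕ.+ essentials-in n x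
  edges≤vertices+essentials n x = ℕ.*-cancelʳ-≤ _ _ 2 (begin
    length (componentE x) ℕ.* 2              ≡⟨ sym (∑-const (componentE x) 2) ⟩
    ∑ (componentE x) (λ _ → 2)               ≤⟨ ∑-mono (componentE x) (λ {e} _ → split (Essential? n e)) ⟩
    ∑ (componentE x) (λ e → level-weight (e , true) ℕ.+ level-weight (e , false) ℕ.+ 2 ℕ.* 𝟙 (Essential? n e))
                                             ≡⟨ ∑-+ (componentE x) _ _ ⟩
    ∑ (componentE x) (λ e → level-weight (e , true) ℕ.+ level-weight (e , false)) ℕ.+ ∑ (componentE x) (λ e → 2 ℕ.* 𝟙 (Essential? n e))
                                             ≡⟨ cong₂ ℕ._+_ (sym (∑-component x level-weight)) (trans (∑-*ˡ (componentE x) 2 _) (ℕ.*-comm 2 (essentials-in n x))) ⟩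
    ∑ (componentV x) (λ v → ∑ (outs v) level-weight) ℕ.+ essentials-in n x ℕ.* 2
                                             ≤⟨ ℕ.+-monoˡ-≤ _ (∑-mono (componentV x) (λ {v} _ → level-weights≤2 (no-branching no-peak) v)) ⟩
    ∑ (componentV x) (λ _ → 2) ℕ.+ essentials-in n x ℕ.* 2
                                             ≡⟨ cong (ℕ._+ essentials-in n x ℕ.* 2) (∑-const (componentV x) 2) ⟩
    length (componentV x) ℕ.* 2 ℕ.+ essentials-in n x ℕ.* 2
                                             ≡⟨ sym (ℕ.*-distribʳ-+ 2 (length (componentV x)) (essentials-in n x)) ⟩
    (length (componentV x) ℕ.+ essentials-in n x) ℕ.* 2 ∎)
    where
    open ℕ.≤-Reasoning
    open Subgraph (Ordinary n) (λ d → ¬? (Essential? n (proj₁ d))) (λ ord → ord) (length darts) ℕ.≤-refl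
    no-peak : ∀ {d} → Ordinary n d → Good d → Good (rev d) → ⊥
    no-peak {d} ord good good′ = ord (good⇒essential n d good good′)
    split : ∀ {e} (ess? : Dec (Essential n e)) →
            2 ℕ.≤ level-weight (e , true) ℕ.+ level-weight (e , false) ℕ.+ 2 ℕ.* 𝟙 ess?
    split     (yes _)  = ℕ.m≤n+m 2 _
    split {e} (no ord) = ℕ.≤-trans (level-weight-pair {e , true} ord) (ℕ.m≤m+n _ _)

  module _ (n : ℕ) (n-large : length darts ℕ.≤ n) where

    -- The shift by one is that of `descend`: `suc n` ordinary darts following an essential one make
    -- a walk for `R` at `n`.
    open Subgraph (Ordinary (suc n)) (λ d → ¬? (Essential? (suc n) (proj₁ d))) (λ ord → ord) n n-large

    essential⇒U : ∀ {d} → Essential (suc n) (proj₁ d) → U (tgt d)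
    essential⇒U {d} ess = outside⇒U (λ {d} ¬ord → essential⇒down d (decidable-stable (Essential? (suc n) (proj₁ d)) ¬ord))
      {d} (λ ord → ord ess)

    U-across : ∀ d → U (src d) → U (tgt d)
    U-across d u with Essential? (suc n) (proj₁ d)
    ... | yes ess = essential⇒U {d} ess
    ... | no ord  = U-pred {rev d} ord (subst (U ∘ src) (sym (rev-involutive d)) u)

    U-connected : ∀ {u v} → Connected u v → U u → U v
    U-connected ε u∈ = u∈
    U-connected (fwd (e , refl , refl) ◅ p) u∈ = U-connected p (U-across (e , true) u∈)
    U-connected (bwd (e , refl , refl) ◅ p) u∈ = U-connected p (U-across (e , false) u∈)

    -- One essential edge puts every vertex of its component into `U`, so each vertex has weight at
    -- least 2, while an ordinary edge supplies at most 2 and an essential one 0.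
    vertices+essentials≤edges : ∀ x {e} → e ∈ componentE x → Essential (suc n) e →
      length (componentV x) ℕ.+ essentials-in (suc n) x ℕ.≤ length (componentE x)
    vertices+essentials≤edges x {e₀} e₀∈ ess₀ = ℕ.*-cancelʳ-≤ _ _ 2 (begin
      (length (componentV x) ℕ.+ essentials-in (suc n) x) ℕ.* 2
                                               ≡⟨ ℕ.*-distribʳ-+ 2 (length (componentV x)) (essentials-in (suc n) x) ⟩
      length (componentV x) ℕ.* 2 ℕ.+ essentials-in (suc n) x ℕ.* 2
                                               ≡⟨ cong (ℕ._+ essentials-in (suc n) x ℕ.* 2) (sym (∑-const (componentV x) 2)) ⟩
      ∑ (componentV x) (λ _ → 2) ℕ.+ essentials-in (suc n) x ℕ.* 2
                                               ≤⟨ ℕ.+-monoˡ-≤ _ (∑-mono (componentV x) (λ v∈ → 2≤R-weights (in-U v∈))) ⟩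
      ∑ (componentV x) (λ v → ∑ (outs v) R-weight) ℕ.+ essentials-in (suc n) x ℕ.* 2
                                               ≡⟨ cong₂ ℕ._+_ (∑-component x R-weight) (trans (ℕ.*-comm (essentials-in (suc n) x) 2) (sym (∑-*ˡ (componentE x) 2 _))) ⟩
      ∑ (componentE x) (λ e → R-weight (e , true) ℕ.+ R-weight (e , false)) ℕ.+ ∑ (componentE x) (λ e → 2 ℕ.* 𝟙 (Essential? (suc n) e))
                                               ≡⟨ sym (∑-+ (componentE x) _ _) ⟩
      ∑ (componentE x) (λ e → R-weight (e , true) ℕ.+ R-weight (e , false) ℕ.+ 2 ℕ.* 𝟙 (Essential? (suc n) e))
                                               ≤⟨ ∑-mono (componentE x) (λ {e} _ → split (Essential? (suc n) e)) ⟩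
      ∑ (componentE x) (λ _ → 2)               ≡⟨ ∑-const (componentE x) 2 ⟩
      length (componentE x) ℕ.* 2              ∎)
      where
      open ℕ.≤-Reasoning
      in-U : ∀ {v} → v ∈ componentV x → U v
      in-U v∈ = U-connected (Connected-trans (Connected-sym (∈-componentE e₀∈)) (∈-componentV v∈))
        (essential⇒U {e₀ , false} ess₀)
      split : ∀ {e} (ess? : Dec (Essential (suc n) e)) →
              R-weight (e , true) ℕ.+ R-weight (e , false) ℕ.+ 2 ℕ.* 𝟙 ess? ℕ.≤ 2
      split {e} (no _)    = ℕ.≤-trans (ℕ.≤-reflexive (ℕ.+-identityʳ _)) (R-weight-pair (e , true))
      split {e} (yes ess) = ℕ.≤-reflexive (cong (ℕ._+ 2) (cong₂ ℕ._+_
        (R-weight-outside {e , true} (λ ord → ord ess)) (R-weight-outside {e , false} (λ ord → ord ess))))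

    essentials≤ρ : + essentials (suc n) ≤ Digraph.ρ digraph
    essentials≤ρ = subst (λ s → + s ≤ Digraph.ρ digraph) (∑-components (𝟙 ∘ Essential? (suc n)))
      (∑-≤-foldr per-component components)
      where
      per-component : ∀ x → + essentials-in (suc n) x ≤ 0ℤ ⊔ (h₁ x - 1ℤ)
      per-component x with any? (Essential? (suc n)) (componentE x)
      -- Such a component may be a tree, where `h₁ x - 1` is negative; the maximum with `0` covers
      -- it.
      ... | no none = subst (λ s → + s ≤ 0ℤ ⊔ (h₁ x - 1ℤ))
              (sym (∑-zero (componentE x) λ {e} e∈ → 𝟙-false (Essential? (suc n) e) (none ∘ lose e∈)))
              (ℤₚ.i≤i⊔j 0ℤ (h₁ x - 1ℤ))
      ... | yes some with find some
      ...   | e , e∈ , ess = ℤₚ.≤-trans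
                (subst (+ essentials-in (suc n) x ≤_) (sym (excess (length (componentE x)) (length (componentV x))))
                  (≤-by₁ (+≤+ (vertices+essentials≤edges x e∈ ess))
                    (eq (+ length (componentE x)) (+ length (componentV x)) (+ essentials-in (suc n) x))))
                (ℤₚ.i≤j⊔i 0ℤ (h₁ x - 1ℤ))
        where
        eq : ∀ i j k → i - j - k ≡ i - (j + k)
        eq = solve-∀

  ρ≤essentials : ∀ n → Digraph.ρ digraph ≤ + essentials n
  ρ≤essentials n = subst (λ s → Digraph.ρ digraph ≤ + s) (∑-components (𝟙 ∘ Essential? n))
    (foldr-≤-∑ per-component components)
    where
    eq : ∀ i j k → k - (i - j) ≡ j + k - i
    eq = solve-∀
    per-component : ∀ x → 0ℤ ⊔ (h₁ x - 1ℤ) ≤ + essentials-in n x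
    per-component x = ℤₚ.⊔-lub (+≤+ ℕ.z≤n)
      (subst (_≤ + essentials-in n x) (sym (excess (length (componentE x)) (length (componentV x))))
        (≤-by₁ (+≤+ (edges≤vertices+essentials n x))
          (eq (+ length (componentE x)) (+ length (componentV x)) (+ essentials-in n x))))

-- The fibre product and its projections

module Product (K L : Bigraph) (étaleK : Étale K) (étaleL : Étale L) where

  K×L : Bigraph
  K×L = record { digraph = K ×B₂ L ; colour = λ ((e , _) , _) → Bigraph.colour K e }

  edge-≡ : {d e : Bigraph.E K×L} → proj₁ d ≡ proj₁ e → d ≡ e
  edge-≡ = Σ-≡ λ _ → Decidable⇒UIP.≡-irrelevant Fin._≟_

  étaleK×L : Étale K×L
  étaleK×L = record
    { head-injective = λ { {_ , c} {_ , c′} eq h → edge-≡ (cong₂ _,_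
        (Étale.head-injective étaleK eq (cong proj₁ h))
        (Étale.head-injective étaleL (trans (sym c) (trans eq c′)) (cong proj₂ h))) }
    ; tail-injective = λ { {_ , c} {_ , c′} eq t → edge-≡ (cong₂ _,_
        (Étale.tail-injective étaleK eq (cong proj₁ t))
        (Étale.tail-injective étaleL (trans (sym c) (trans eq c′)) (cong proj₂ t))) }
    }

  module WK = Walks K étaleK
  module WL = Walks L étaleL
  module WM = Walks K×L étaleK×L

  πK : WM.Dart → WK.Dart
  πK (((e , _) , _) , b) = e , b

  πL : WM.Dart → WL.Dart
  πL (((_ , e) , _) , b) = e , b

  src-πK : ∀ x → WK.src (πK x) ≡ proj₁ (WM.src x)
  src-πK (_ , true)  = refl
  src-πK (_ , false) = refl

  src-πL : ∀ x → WL.src (πL x) ≡ proj₂ (WM.src x)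
  src-πL (_ , true)  = refl
  src-πL (_ , false) = refl

  -- The product takes its colours from `K`, so the analogue for `πK` holds by definition; for `πL`
  -- the agreement of colours enters.
  kind-πL : ∀ x → WL.kind (πL x) ≡ WM.kind x
  kind-πL ((_ , c) , b) = cong (rank b) (sym c)

  cross-πK : ∀ x → WK.cross (πK x) ≡ WM.cross x
  cross-πK (_ , true)  = refl
  cross-πK (_ , false) = refl

  cross-πL : ∀ x → WL.cross (πL x) ≡ WM.cross x
  cross-πL (_ , true)  = refl
  cross-πL (_ , false) = refl

  turn-πL : ∀ x y → WL.turn (πL x) (πL y) ≡ WM.turn x y
  turn-πL x y = cong₂ σ (kind-πL (WM.rev x)) (kind-πL y)

  src-cont-K : ∀ {x y} → WM.Cont x y → WK.tgt (πK x) ≡ WK.src (πK y)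
  src-cont-K {x} {y} (s , _) = trans (src-πK (WM.rev x)) (trans (cong proj₁ s) (sym (src-πK y)))

  src-cont-L : ∀ {x y} → WM.Cont x y → WL.tgt (πL x) ≡ WL.src (πL y)
  src-cont-L {x} {y} (s , _) = trans (src-πL (WM.rev x)) (trans (cong proj₂ s) (sym (src-πL y)))

  -- The turn at a vertex is determined by the kinds of the two darts, so a projection that
  -- backtracks forces the walk in the fibre product to backtrack.
  cont-K : ∀ {x y} → WM.Cont x y → WK.Cont (πK x) (πK y)
  cont-K {x} {y} c@(s , y≢) = src-cont-K {x} {y} c , λ eq → y≢ (WM.kind-injective (sym s) (cong WK.kind eq))

  cont-L : ∀ {x y} → WM.Cont x y → WL.Cont (πL x) (πL y)
  cont-L {x} {y} c@(s , y≢) = src-cont-L {x} {y} c , λ eq → y≢ (WM.kind-injective (sym s)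
    (trans (sym (kind-πL y)) (trans (cong WL.kind eq) (kind-πL (WM.rev x)))))

  -- A projection keeps colours and directions, hence turns, crossings and all partial sums.
  down-K : ∀ n {s x} → WM.Down n s x → WK.Down n s (πK x)
  down-K zero    _ = tt
  down-K (suc n) {s} {x} (y , c , neg , d) = πK y , cont-K {x} {y} c , neg ,
    subst (λ o → WK.Down n (s + WM.turn x y + o) (πK y)) (sym (cross-πK y)) (down-K n d)

  down-L : ∀ n {s x} → WM.Down n s x → WL.Down n s (πL x)
  down-L zero    _ = tt
  down-L (suc n) {s} {x} (y , c , neg , d) = πL y , cont-L {x} {y} c ,
    subst (λ t → s + t ≤ -1ℤ) (sym (turn-πL x y)) neg ,
    subst₂ (λ t o → WL.Down n (s + t + o) (πL y)) (sym (turn-πL x y)) (sym (cross-πL y)) (down-L n d)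

  -- An edge of the product is determined by its two underlying edges, and these inherit both
  -- descents.
  essentials-product : ∀ n → WM.essentials n ℕ.≤ WK.essentials n ℕ.* WL.essentials n
  essentials-product n = begin
    WM.essentials n                                     ≡⟨ sym (length-filter-∑ (WM.Essential? n) WM.edges) ⟩
    length (filter (WM.Essential? n) WM.edges)          ≤⟨ length-injection (≡-dec (finite⇒≟ WK.finE) (finite⇒≟ WL.finE)) proj₁
                                                             (Unique.filter⁺ (WM.Essential? n) (elements-unique WM.finE)) edge-≡ projects ⟩
    length (cartesianProduct EK EL)                     ≡⟨ length-cartesianProduct EK EL ⟩
    length EK ℕ.* length EL                             ≡⟨ cong₂ ℕ._*_ (length-filter-∑ (WK.Essential? n) WK.edges) (length-filter-∑ (WL.Essential? n) WL.edges) ⟩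
    WK.essentials n ℕ.* WL.essentials n                 ∎
    where
    open ℕ.≤-Reasoning
    EK = filter (WK.Essential? n) WK.edges
    EL = filter (WL.Essential? n) WL.edges
    projects : ∀ {e} → e ∈ filter (WM.Essential? n) WM.edges → proj₁ e ∈ cartesianProduct EK EL
    projects {e} e∈ with ∈-filter⁻ (WM.Essential? n) {xs = WM.edges} e∈
    ... | _ , (down , down′) = ∈-cartesianProduct⁺
      (∈-filter⁺ (WK.Essential? n) (∈-elements WK.finE _) (down-K n down , down-K n down′))
      (∈-filter⁺ (WL.Essential? n) (∈-elements WL.finE _) (down-L n down , down-L n down′))

theorem2p2 : (K L : Bigraph) → Étale K → Étale L → ρ (K ×B₂ L) ≤ ρ (Bigraph.digraph K) * ρ (Bigraph.digraph L)
theorem2p2 K L étaleK étaleL = begin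
  ρ (K ×B₂ L)                                           ≤⟨ WM.ρ≤essentials (suc n) ⟩
  + WM.essentials (suc n)                               ≤⟨ +≤+ (essentials-product (suc n)) ⟩
  + (WK.essentials (suc n) ℕ.* WL.essentials (suc n))   ≡⟨ ℤₚ.pos-* (WK.essentials (suc n)) (WL.essentials (suc n)) ⟩
  + WK.essentials (suc n) * + WL.essentials (suc n)     ≤⟨ ℤₚ.*-monoˡ-≤-nonNeg (+ WK.essentials (suc n))
                                                             (WL.essentials≤ρ n (ℕ.m≤n+m (length WL.darts) (length WK.darts))) ⟩
  + WK.essentials (suc n) * ρ (Bigraph.digraph L)       ≤⟨ ℤₚ.*-monoʳ-≤-nonNeg (ρ (Bigraph.digraph L)) {{ℤ.nonNegative 0≤ρL}}
                                                             (WK.essentials≤ρ n (ℕ.m≤m+n (length WK.darts) (length WL.darts))) ⟩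
  ρ (Bigraph.digraph K) * ρ (Bigraph.digraph L)         ∎
  where
  open ℤₚ.≤-Reasoning
  open Product K L étaleK étaleL
  -- At least the number of darts of either factor, as `essentials≤ρ` requires; `ρ≤essentials` for
  -- the product holds at any length.
  n : ℕ
  n = length WK.darts ℕ.+ length WL.darts
  0≤ρL : 0ℤ ≤ ρ (Bigraph.digraph L)
  0≤ρL = ℤₚ.≤-trans (+≤+ ℕ.z≤n) (WL.essentials≤ρ n (ℕ.m≤n+m (length WL.darts) (length WK.darts)))
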